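{- $\left\{(r_0,r_1)\in\mathbb{R}^2 \mid r_0-r_1>-\tfrac12,\ r_1\ge\max\{ -2\sqrt{r_0},-r_0\},\ r_0>\tfrac32+\sqrt2\right\}\subset\mathcal{D}_2^{(*)}$.
   Context: For $\mathbf{r}=(r_0,r_1)\in\mathbb{R}^2$, the two-dimensional shift radix system is the map $\tau_{\mathbf{r}}:\mathbb{Z}^2\to\mathbb{Z}^2$, $\tau_{\mathbf{r}}(a_0,a_1)=(a_1,-\lfloor r_0a_0+r_1a_1\rfloor)$. The orbit of $(a_0,a_1)$ is identified with the integer sequence $(a_n)_{n\ge 0}$ where $a_{n+2}=-\lfloor r_0a_n+r_1a_{n+1}\rfloor$ for $n\ge0$. An orbit is ultimately periodic if there are $n_0\ge 0$, $p>0$ with $a_{n+p}=a_n$ for all $n\ge n_0$; it ends up in the trivial cycle if $a_n=0$ for all sufficiently large $n$. $\mathcal{D}_2^{(*)}$ is the set of all $\mathbf{r}\in\mathbb{R}^2$ such that each ultimately periodic orbit of $\tau_{\mathbf{r}}$ ends up in the trivial cycle. -}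

module Defs where

open import Data.Nat as ℕ using (ℕ; suc)
import Data.Nat.Properties as ℕ
open import Data.Integer as ℤ using (ℤ; +_)
open import Data.Rational as ℚ using (ℚ; 0ℚ; 1ℚ; ½; ∣_∣)
import Data.Rational.Properties as ℚ
open import Data.Product using (∃-syntax; _×_; _,_)
open import Data.Sum using (inj₁; inj₂)
open import Relation.Nullary.Decidable using (dec⇒maybe)
open import Tactic.RingSolver using (solve-∀)
open import Tactic.RingSolver.Core.AlmostCommutativeRing
  using (AlmostCommutativeRing; fromCommutativeRing)
open import Relation.Binary.PropositionalEquality
  using (_≡_; refl; sym; trans; cong; cong₂; subst)

infixl 7 _*_
infixl 6 _+_ _-_ _⊔_
infix  8 -_
infix  4 _≈_ _<_ _≤_ _>_ _≥_

-- ℝ is the Cauchy completion of ℚ: rational Cauchy sequences, with the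
-- equality _≈_ below.

IsCauchy : (ℕ → ℚ) → Set
IsCauchy x = ∀ ε → 0ℚ ℚ.< ε →
  ∃[ N ] (∀ m n → N ℕ.≤ m → N ℕ.≤ n → ∣ x m ℚ.- x n ∣ ℚ.≤ ε)

record ℝ : Set where
  constructor mkℝ
  field
    seq    : ℕ → ℚ
    cauchy : IsCauchy seq

open ℝ public

_≈_ : ℝ → ℝ → Set
x ≈ y = ∀ ε → 0ℚ ℚ.< ε →
  ∃[ N ] (∀ n → N ℕ.≤ n → ∣ seq x n ℚ.- seq y n ∣ ℚ.≤ ε)

_<_ : ℝ → ℝ → Set
x < y = ∃[ ε ] (0ℚ ℚ.< ε ×
  ∃[ N ] (∀ n → N ℕ.≤ n → seq x n ℚ.+ ε ℚ.≤ seq y n))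

-- Slack ε is needed: the inequality need not hold termwise, even eventually.
_≤_ : ℝ → ℝ → Set
x ≤ y = ∀ ε → 0ℚ ℚ.< ε →
  ∃[ N ] (∀ n → N ℕ.≤ n → seq x n ℚ.≤ seq y n ℚ.+ ε)

_>_ : ℝ → ℝ → Set
x > y = y < x

_≥_ : ℝ → ℝ → Set
x ≥ y = y ≤ x

private

  ℚ-ring : AlmostCommutativeRing _ _
  ℚ-ring = fromCommutativeRing ℚ.+-*-commutativeRing (λ x → dec⇒maybe (0ℚ ℚ.≟ x))

  swap-identity : ∀ p q → ℚ.- (p ℚ.- q) ≡ q ℚ.- p
  swap-identity = solve-∀ ℚ-ring

  neg-identity : ∀ p q → q ℚ.- p ≡ ℚ.- p ℚ.- (ℚ.- q)
  neg-identity = solve-∀ ℚ-ring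

  add-sub : ∀ p q → (p ℚ.+ q) ℚ.- q ≡ p
  add-sub = solve-∀ ℚ-ring

  sub-add : ∀ p q → p ≡ (p ℚ.- q) ℚ.+ q
  sub-add = solve-∀ ℚ-ring

  +-identity : ∀ a b c d →
    (a ℚ.+ b) ℚ.- (c ℚ.+ d) ≡ (a ℚ.- c) ℚ.+ (b ℚ.- d)
  +-identity = solve-∀ ℚ-ring

  *-identity : ∀ a b c d →
    a ℚ.* b ℚ.- c ℚ.* d ≡ a ℚ.* (b ℚ.- d) ℚ.+ d ℚ.* (a ℚ.- c)
  *-identity = solve-∀ ℚ-ring

  ∣∣≤ : ∀ {p q} → p ℚ.≤ q → ℚ.- p ℚ.≤ q → ∣ p ∣ ℚ.≤ q
  ∣∣≤ {p} {q} p≤q -p≤q with ℚ.∣p∣≡p∨∣p∣≡-p p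
  ... | inj₁ e = subst (ℚ._≤ q) (sym e) p≤q
  ... | inj₂ e = subst (ℚ._≤ q) (sym e) -p≤q

  ≤∣∣ : ∀ p → p ℚ.≤ ∣ p ∣
  ≤∣∣ p with ℚ.≤-total 0ℚ p
  ... | inj₁ 0≤p = ℚ.≤-reflexive (sym (ℚ.0≤p⇒∣p∣≡p 0≤p))
  ... | inj₂ p≤0 = ℚ.≤-trans p≤0 (ℚ.0≤∣p∣ p)

  ∣-∣-comm : ∀ p q → ∣ p ℚ.- q ∣ ≡ ∣ q ℚ.- p ∣
  ∣-∣-comm p q = trans (sym (ℚ.∣-p∣≡∣p∣ (p ℚ.- q)))
    (cong ∣_∣ (swap-identity p q))

  *-pos : ∀ c {ε} .{{_ : ℚ.Positive c}} → 0ℚ ℚ.< ε → 0ℚ ℚ.< c ℚ.* ε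
  *-pos c {ε} 0<ε =
    subst (λ z → z ℚ.< c ℚ.* ε) (ℚ.*-zeroʳ c) (ℚ.*-monoʳ-<-pos c {0ℚ} {ε} 0<ε)

  half+half : ∀ ε → ½ ℚ.* ε ℚ.+ ½ ℚ.* ε ≡ ε
  half+half ε = trans (sym (ℚ.*-distribʳ-+ ε ½ ½))
    (trans (cong (λ c → c ℚ.* ε) ½+½) (ℚ.*-identityˡ ε))
    where
    ½+½ : ½ ℚ.+ ½ ≡ 1ℚ
    ½+½ = refl

  +-cauchy : ∀ {x y} → IsCauchy x → IsCauchy y → IsCauchy (λ n → x n ℚ.+ y n)
  +-cauchy {x} {y} cx cy ε 0<ε
    with M , p ← cx (½ ℚ.* ε) (*-pos ½ 0<ε)
       | N , q ← cy (½ ℚ.* ε) (*-pos ½ 0<ε)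
    = M ℕ.⊔ N , λ m n h k → begin
    ∣ (x m ℚ.+ y m) ℚ.- (x n ℚ.+ y n) ∣
      ≡⟨ cong ∣_∣ (+-identity (x m) (y m) (x n) (y n)) ⟩
    ∣ (x m ℚ.- x n) ℚ.+ (y m ℚ.- y n) ∣
      ≤⟨ ℚ.∣p+q∣≤∣p∣+∣q∣ (x m ℚ.- x n) (y m ℚ.- y n) ⟩
    ∣ x m ℚ.- x n ∣ ℚ.+ ∣ y m ℚ.- y n ∣
      ≤⟨ ℚ.+-mono-≤
           (p m n (ℕ.m⊔n≤o⇒m≤o M N h) (ℕ.m⊔n≤o⇒m≤o M N k))
           (q m n (ℕ.m⊔n≤o⇒n≤o M N h) (ℕ.m⊔n≤o⇒n≤o M N k)) ⟩
    ½ ℚ.* ε ℚ.+ ½ ℚ.* ε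
      ≡⟨ half+half ε ⟩
    ε ∎
    where open ℚ.≤-Reasoning

  neg-cauchy : ∀ {x} → IsCauchy x → IsCauchy (λ n → ℚ.- x n)
  neg-cauchy {x} cx ε 0<ε with N , p ← cx ε 0<ε = N , λ m n h k →
    subst (ℚ._≤ ε)
      (trans (∣-∣-comm (x m) (x n))
        (cong ∣_∣ (neg-identity (x m) (x n))))
      (p m n h k)

  bounded : ∀ {x} → IsCauchy x →
    ∃[ B ] (0ℚ ℚ.< B × ∃[ N ] (∀ n → N ℕ.≤ n → ∣ x n ∣ ℚ.≤ B))
  bounded {x} cx with N , p ← cx 1ℚ (ℚ.positive⁻¹ 1ℚ) =
    ∣ x N ∣ ℚ.+ 1ℚ , ℚ.+-mono-≤-< (ℚ.0≤∣p∣ (x N)) (ℚ.positive⁻¹ 1ℚ) , N , λ n h → begin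
    ∣ x n ∣
      ≡⟨ cong ∣_∣ (trans (sub-add (x n) (x N)) (ℚ.+-comm (x n ℚ.- x N) (x N))) ⟩
    ∣ x N ℚ.+ (x n ℚ.- x N) ∣
      ≤⟨ ℚ.∣p+q∣≤∣p∣+∣q∣ (x N) (x n ℚ.- x N) ⟩
    ∣ x N ∣ ℚ.+ ∣ x n ℚ.- x N ∣
      ≤⟨ ℚ.+-monoʳ-≤ ∣ x N ∣ (p n N h ℕ.≤-refl) ⟩
    ∣ x N ∣ ℚ.+ 1ℚ ∎
    where open ℚ.≤-Reasoning

  *-mono-∣∣ : ∀ {p q b c} → ∣ p ∣ ℚ.≤ b → ∣ q ∣ ℚ.≤ c → 0ℚ ℚ.< b →
    ∣ p ℚ.* q ∣ ℚ.≤ b ℚ.* c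
  *-mono-∣∣ {p} {q} {b} {c} h k 0<b = begin
    ∣ p ℚ.* q ∣       ≡⟨ ℚ.∣p*q∣≡∣p∣*∣q∣ p q ⟩
    ∣ p ∣ ℚ.* ∣ q ∣   ≤⟨ ℚ.*-monoʳ-≤-nonNeg ∣ q ∣ {{ℚ.∣-∣-nonNeg q}} h ⟩
    b ℚ.* ∣ q ∣       ≤⟨ ℚ.*-monoˡ-≤-nonNeg b {{ℚ.nonNegative (ℚ.<⇒≤ 0<b)}} k ⟩
    b ℚ.* c           ∎
    where open ℚ.≤-Reasoning

  divide : ∀ c → 0ℚ ℚ.< c → ∀ ε → 0ℚ ℚ.< ε → ∃[ δ ] (0ℚ ℚ.< δ × c ℚ.* δ ≡ ε)
  divide c 0<c ε 0<ε = c⁻¹ ℚ.* ε , *-pos c⁻¹ {{c⁻¹-pos}} 0<ε ,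
    trans (sym (ℚ.*-assoc c c⁻¹ ε))
      (trans (cong (λ d → d ℚ.* ε) (ℚ.*-inverseʳ c {{c≢0}})) (ℚ.*-identityˡ ε))
    where
    c-pos : ℚ.Positive c
    c-pos = ℚ.positive 0<c
    c≢0 : ℚ.NonZero c
    c≢0 = ℚ.pos⇒nonZero c {{c-pos}}
    c⁻¹ : ℚ
    c⁻¹ = ℚ.1/_ c {{c≢0}}
    c⁻¹-pos : ℚ.Positive c⁻¹
    c⁻¹-pos = ℚ.1/pos⇒pos c {{c-pos}}

  *-close : ∀ a b c d A B δ → 0ℚ ℚ.< A → 0ℚ ℚ.< B → ∣ a ∣ ℚ.≤ A → ∣ d ∣ ℚ.≤ B →
    ∣ a ℚ.- c ∣ ℚ.≤ δ → ∣ b ℚ.- d ∣ ℚ.≤ δ →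
    ∣ a ℚ.* b ℚ.- c ℚ.* d ∣ ℚ.≤ (A ℚ.+ B) ℚ.* δ
  *-close a b c d A B δ 0<A 0<B a≤A d≤B a-c≤δ b-d≤δ = begin
    ∣ a ℚ.* b ℚ.- c ℚ.* d ∣
      ≡⟨ cong ∣_∣ (*-identity a b c d) ⟩
    ∣ a ℚ.* (b ℚ.- d) ℚ.+ d ℚ.* (a ℚ.- c) ∣
      ≤⟨ ℚ.∣p+q∣≤∣p∣+∣q∣ (a ℚ.* (b ℚ.- d)) (d ℚ.* (a ℚ.- c)) ⟩
    ∣ a ℚ.* (b ℚ.- d) ∣ ℚ.+ ∣ d ℚ.* (a ℚ.- c) ∣
      ≤⟨ ℚ.+-mono-≤ (*-mono-∣∣ {a} {b ℚ.- d} {A} {δ} a≤A b-d≤δ 0<A)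
                    (*-mono-∣∣ {d} {a ℚ.- c} {B} {δ} d≤B a-c≤δ 0<B) ⟩
    A ℚ.* δ ℚ.+ B ℚ.* δ
      ≡⟨ sym (ℚ.*-distribʳ-+ δ A B) ⟩
    (A ℚ.+ B) ℚ.* δ ∎
    where open ℚ.≤-Reasoning

  *-cauchy : ∀ {x y} → IsCauchy x → IsCauchy y → IsCauchy (λ n → x n ℚ.* y n)
  *-cauchy {x} {y} cx cy ε 0<ε =
    let A , 0<A , K , a = bounded {x} cx
        B , 0<B , L , b = bounded {y} cy
        δ , 0<δ , Cδ≡ε  = divide (A ℚ.+ B) (ℚ.+-mono-< {0ℚ} {A} {0ℚ} {B} 0<A 0<B) ε 0<ε
        M , p = cx δ 0<δ
        N , q = cy δ 0<δ
    in (K ℕ.⊔ L) ℕ.⊔ (M ℕ.⊔ N) , λ m n h k →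
      let KLm = ℕ.m⊔n≤o⇒m≤o (K ℕ.⊔ L) (M ℕ.⊔ N) h
          KLn = ℕ.m⊔n≤o⇒m≤o (K ℕ.⊔ L) (M ℕ.⊔ N) k
          MNm = ℕ.m⊔n≤o⇒n≤o (K ℕ.⊔ L) (M ℕ.⊔ N) h
          MNn = ℕ.m⊔n≤o⇒n≤o (K ℕ.⊔ L) (M ℕ.⊔ N) k
      in subst (λ e → ∣ x m ℚ.* y m ℚ.- x n ℚ.* y n ∣ ℚ.≤ e) Cδ≡ε
           (*-close (x m) (y m) (x n) (y n) A B δ 0<A 0<B
             (a m (ℕ.m⊔n≤o⇒m≤o K L KLm))
             (b n (ℕ.m⊔n≤o⇒n≤o K L KLn))
             (p m n (ℕ.m⊔n≤o⇒m≤o M N MNm) (ℕ.m⊔n≤o⇒m≤o M N MNn))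
             (q m n (ℕ.m⊔n≤o⇒n≤o M N MNm) (ℕ.m⊔n≤o⇒n≤o M N MNn)))

  ⊔-shift : ∀ {a b c d e} → ∣ a ℚ.- c ∣ ℚ.≤ e → ∣ b ℚ.- d ∣ ℚ.≤ e →
    (a ℚ.⊔ b) ℚ.- (c ℚ.⊔ d) ℚ.≤ e
  ⊔-shift {a} {b} {c} {d} {e} h k = begin
    (a ℚ.⊔ b) ℚ.- s    ≤⟨ ℚ.+-monoˡ-≤ (ℚ.- s) (ℚ.⊔-lub
                            (step a c h (ℚ.p≤p⊔q c d)) (step b d k (ℚ.p≤q⊔p c d))) ⟩
    (e ℚ.+ s) ℚ.- s    ≡⟨ add-sub e s ⟩
    e                  ∎
    where
    open ℚ.≤-Reasoning
    s : ℚ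
    s = c ℚ.⊔ d
    step : ∀ u v → ∣ u ℚ.- v ∣ ℚ.≤ e → v ℚ.≤ s → u ℚ.≤ e ℚ.+ s
    step u v u-v≤e v≤s = begin
      u                  ≡⟨ sub-add u v ⟩
      (u ℚ.- v) ℚ.+ v    ≤⟨ ℚ.+-mono-≤ (ℚ.≤-trans (≤∣∣ (u ℚ.- v)) u-v≤e) v≤s ⟩
      e ℚ.+ s            ∎

  ⊔-cauchy : ∀ {x y} → IsCauchy x → IsCauchy y → IsCauchy (λ n → x n ℚ.⊔ y n)
  ⊔-cauchy {x} {y} cx cy ε 0<ε
    with M , p ← cx ε 0<ε | N , q ← cy ε 0<ε
    = M ℕ.⊔ N , λ m n h k →
      let Mm = ℕ.m⊔n≤o⇒m≤o M N h
          Mn = ℕ.m⊔n≤o⇒m≤o M N k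
          Nm = ℕ.m⊔n≤o⇒n≤o M N h
          Nn = ℕ.m⊔n≤o⇒n≤o M N k
      in ∣∣≤ (⊔-shift {x m} {y m} {x n} {y n} (p m n Mm Mn) (q m n Nm Nn))
           (subst (ℚ._≤ ε)
             (sym (swap-identity (x m ℚ.⊔ y m) (x n ℚ.⊔ y n)))
             (⊔-shift {x n} {y n} {x m} {y m} (p n m Mn Mm) (q n m Nn Nm)))

fromℚ : ℚ → ℝ
fromℚ p = mkℝ (λ _ → p) λ ε 0<ε → 0 , λ _ _ _ _ →
  subst (λ d → ∣ d ∣ ℚ.≤ ε) (sym (ℚ.+-inverseʳ p)) (ℚ.<⇒≤ 0<ε)

fromℤ : ℤ → ℝ
fromℤ i = fromℚ (i ℚ./ 1)

_+_ : ℝ → ℝ → ℝ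
x + y = mkℝ (λ n → seq x n ℚ.+ seq y n) (+-cauchy {seq x} {seq y} (cauchy x) (cauchy y))

-_ : ℝ → ℝ
- x = mkℝ (λ n → ℚ.- seq x n) (neg-cauchy {seq x} (cauchy x))

_-_ : ℝ → ℝ → ℝ
x - y = x + (- y)

_*_ : ℝ → ℝ → ℝ
x * y = mkℝ (λ n → seq x n ℚ.* seq y n) (*-cauchy {seq x} {seq y} (cauchy x) (cauchy y))

_⊔_ : ℝ → ℝ → ℝ
x ⊔ y = mkℝ (λ n → seq x n ℚ.⊔ seq y n) (⊔-cauchy {seq x} {seq y} (cauchy x) (cauchy y))

-- s = √ x
IsSqrt : ℝ → ℝ → Set
IsSqrt x s = fromℤ (+ 0) ≤ s × s * s ≈ x

-- k = ⌊ x ⌋.  The floor is given by its graph, since it is not computable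
-- on Cauchy sequences.
IsFloor : ℝ → ℤ → Set
IsFloor x k = fromℤ k ≤ x × x < fromℤ (k ℤ.+ + 1)

-- The graph of τ_r : ℤ² → ℤ², (a₀ , a₁) ↦ (a₁ , - ⌊ r₀ a₀ + r₁ a₁ ⌋).
τ : ℝ × ℝ → ℤ × ℤ → ℤ × ℤ → Set
τ (r₀ , r₁) (a₀ , a₁) (b₀ , b₁) =
  b₀ ≡ a₁ × ∃[ k ] (IsFloor (r₀ * fromℤ a₀ + r₁ * fromℤ a₁) k × b₁ ≡ ℤ.- k)

IsOrbit : ℝ × ℝ → (ℕ → ℤ) → Set
IsOrbit r a = ∀ n →
  τ r (a n , a (suc n)) (a (suc n) , a (suc (suc n)))

UltimatelyPeriodic : (ℕ → ℤ) → Set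
UltimatelyPeriodic a =
  ∃[ n₀ ] ∃[ p ] (0 ℕ.< p × (∀ n → n₀ ℕ.≤ n → a (n ℕ.+ p) ≡ a n))

EndsInTrivialCycle : (ℕ → ℤ) → Set
EndsInTrivialCycle a = ∃[ N ] (∀ n → N ℕ.≤ n → a n ≡ + 0)

𝒟₂* : ℝ × ℝ → Set
𝒟₂* r = ∀ a → IsOrbit r a → UltimatelyPeriodic a → EndsInTrivialCycle a

{-# OPTIONS --safe #-}

-- Let b be a periodic orbit and c a difference of two of its shifts, so that
-- |r₀ cₙ + r₁ cₙ₊₁ + cₙ₊₂| ≤ 1.  Both roots of x² + r₁ x + r₀ lie outside the unit
-- disc, and looking at maxima over a period bounds c.  If |r₁| ≤ 2 s with s = √r₀, the form
-- r₀ a² + r₁ a b + b² grows by the factor r₀ along the linear map, which gives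
-- (s - 1)² |c| ≤ 1; if r₁ ≥ 2 s, the factorisation into two expanding first-order
-- steps gives (r₀ - r₁ + 1) |c| ≤ 1.  The hypotheses make both coefficients exceed 1/2,
-- so |c| < 2 and b takes at most two values, which are consecutive integers; a sign
-- argument using r₀ + r₁ ≥ 0 then leaves only b = 0.
--
-- A periodic orbit involves finitely many strict inequalities, so r₀, r₁, √r₀ and √2
-- may be replaced by late terms of their rational sequences, and everything above
-- happens in ℚ.

module Submission where

open import Data.Nat as ℕ using (ℕ; zero; suc)
import Data.Nat.DivMod as ℕ
import Data.Nat.Properties as ℕ
open import Data.Integer as ℤ using (ℤ)
import Data.Integer.Properties as ℤ
open import Data.Rational as ℚ using (ℚ; 0ℚ; 1ℚ; ½)
import Data.Rational.Properties as ℚ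
import Data.Rational.Unnormalised as ℚᵘ
import Data.Rational.Unnormalised.Properties as ℚᵘ
open import Data.List using ([]; _∷_)
open import Data.Product using (∃-syntax; _×_; proj₁; proj₂)
open import Data.Sum using (_⊎_; inj₁; inj₂)
open import Data.Empty using (⊥; ⊥-elim)
open import Relation.Nullary using (¬_; yes; no)
open import Relation.Nullary.Decidable using (dec⇒maybe)
open import Tactic.RingSolver using (solve; solve-∀)
open import Tactic.RingSolver.Core.AlmostCommutativeRing
  using (AlmostCommutativeRing; fromCommutativeRing)
open import Relation.Binary.PropositionalEquality
  using (_≡_; refl; sym; trans; cong; cong₂; subst)
open import Data.Integer using (+_)
open import Data.Rational using (_/_; -½)
open import Data.Product using (_,_)

-- Ordered-field arithmetic in ℚ and the embedding of ℤ.

module RationalArithmetic where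

  open import Data.Rational using (_+_; _*_; -_; _-_; _≤_; _<_; ∣_∣)

  ℚ-ring : AlmostCommutativeRing _ _
  ℚ-ring = fromCommutativeRing ℚ.+-*-commutativeRing (λ x → dec⇒maybe (0ℚ ℚ.≟ x))

  2ℚ : ℚ
  2ℚ = + 2 ℚ./ 1

  ≤⇒0≤ : ∀ {x y} → x ≤ y → 0ℚ ≤ y - x
  ≤⇒0≤ {x} {y} x≤y = subst (_≤ y - x) (ℚ.+-inverseʳ x) (ℚ.+-monoˡ-≤ (- x) x≤y)

  <⇒0< : ∀ {x y} → x < y → 0ℚ < y - x
  <⇒0< {x} {y} x<y = subst (_< y - x) (ℚ.+-inverseʳ x) (ℚ.+-monoˡ-< (- x) x<y)

  private
    cancel : ∀ x y → (y - x) + x ≡ y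
    cancel = solve-∀ ℚ-ring

  infix 1 ≤-by_∵_ <-by_∵_

  -- Inequalities are proved by certificates: the difference of the two sides is written as a
  -- combination of quantities of known sign, assembled with `_⊕_` and `_⊗_`, and the ring solver
  -- checks the identity.
  ≤-by_∵_ : ∀ {x y z} → 0ℚ ≤ z → y - x ≡ z → x ≤ y
  ≤-by_∵_ {x} {y} 0≤z refl = begin
    x              ≡⟨ ℚ.+-identityˡ x ⟨
    0ℚ + x         ≤⟨ ℚ.+-monoˡ-≤ x 0≤z ⟩
    (y - x) + x    ≡⟨ cancel x y ⟩
    y              ∎
    where open ℚ.≤-Reasoning

  <-by_∵_ : ∀ {x y z} → 0ℚ < z → y - x ≡ z → x < y
  <-by_∵_ {x} {y} 0<z refl = begin-strict
    x              ≡⟨ ℚ.+-identityˡ x ⟨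
    0ℚ + x         <⟨ ℚ.+-monoˡ-< x 0<z ⟩
    (y - x) + x    ≡⟨ cancel x y ⟩
    y              ∎
    where open ℚ.≤-Reasoning

  infixl 6 _⊕_ _⊕<_
  infixl 7 _⊗_ _⊗<_

  _⊕_ : ∀ {x y} → 0ℚ ≤ x → 0ℚ ≤ y → 0ℚ ≤ x + y
  _⊕_ = ℚ.+-mono-≤

  _⊕<_ : ∀ {x y} → 0ℚ ≤ x → 0ℚ < y → 0ℚ < x + y
  _⊕<_ = ℚ.+-mono-≤-<

  _⊗_ : ∀ {x y} → 0ℚ ≤ x → 0ℚ ≤ y → 0ℚ ≤ x * y
  _⊗_ {x} {y} 0≤x 0≤y = subst (_≤ x * y) (ℚ.*-zeroʳ x)
    (ℚ.*-monoˡ-≤-nonNeg x {{ℚ.nonNegative 0≤x}} 0≤y)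

  _⊗<_ : ∀ {x y} → 0ℚ < x → 0ℚ < y → 0ℚ < x * y
  _⊗<_ {x} {y} 0<x 0<y = subst (_< x * y) (ℚ.*-zeroʳ x)
    (ℚ.*-monoʳ-<-pos x {{ℚ.positive 0<x}} 0<y)

  0≤½ : 0ℚ ≤ ½
  0≤½ = ℚ.nonNegative⁻¹ ½

  0<½ : 0ℚ < ½
  0<½ = ℚ.positive⁻¹ ½

  0≤1 : 0ℚ ≤ 1ℚ
  0≤1 = ℚ.nonNegative⁻¹ 1ℚ

  0<1 : 0ℚ < 1ℚ
  0<1 = ℚ.positive⁻¹ 1ℚ

  0≤2 : 0ℚ ≤ 2ℚ
  0≤2 = ℚ.nonNegative⁻¹ 2ℚ

  0≤x² : ∀ x → 0ℚ ≤ x * x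
  0≤x² x with ℚ.≤-total 0ℚ x
  ... | inj₁ 0≤x = 0≤x ⊗ 0≤x
  ... | inj₂ x≤0 = ≤-by ≤⇒0≤ x≤0 ⊗ ≤⇒0≤ x≤0 ∵ solve (x ∷ []) ℚ-ring

  0≤-cancel : ∀ {k x} → 0ℚ < k → 0ℚ ≤ k * x → 0ℚ ≤ x
  0≤-cancel {k} {x} 0<k 0≤kx = ℚ.*-cancelˡ-≤-pos k {{ℚ.positive 0<k}}
    (subst (_≤ k * x) (sym (ℚ.*-zeroʳ k)) 0≤kx)

  x≤∣x∣ : ∀ x → x ≤ ∣ x ∣
  x≤∣x∣ x with ℚ.≤-total 0ℚ x
  ... | inj₁ 0≤x = ℚ.≤-reflexive (sym (ℚ.0≤p⇒∣p∣≡p 0≤x))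
  ... | inj₂ x≤0 = ℚ.≤-trans x≤0 (ℚ.0≤∣p∣ x)

  -x≤∣x∣ : ∀ x → - x ≤ ∣ x ∣
  -x≤∣x∣ x = subst (- x ≤_) (ℚ.∣-p∣≡∣p∣ x) (x≤∣x∣ (- x))

  ∣x∣≤ : ∀ {x y} → x ≤ y → - x ≤ y → ∣ x ∣ ≤ y
  ∣x∣≤ {x} {y} x≤y -x≤y with ℚ.∣p∣≡p∨∣p∣≡-p x
  ... | inj₁ eq = subst (_≤ y) (sym eq) x≤y
  ... | inj₂ eq = subst (_≤ y) (sym eq) -x≤y

  -- Definitionally each term of `seq (fromℤ i)`, so hypotheses about reals unfold directly to
  -- statements about `ι`.
  ι : ℤ → ℚ
  ι i = i ℚ./ 1

  private
    -- `i / 1` does not reduce for a variable `i`, so facts about `ι` are checked on unnormalised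
    -- fractions; the 0 stored there is the denominator minus one.
    toℚᵘ-ι : ∀ i → ℚ.toℚᵘ (ι i) ℚᵘ.≃ ℚᵘ.mkℚᵘ i 0
    toℚᵘ-ι i = ℚ.toℚᵘ-fromℚᵘ (ℚᵘ.mkℚᵘ i 0)

  ι-+ : ∀ i j → ι (i ℤ.+ j) ≡ ι i + ι j
  ι-+ i j = ℚ.toℚᵘ-injective (begin
    ℚ.toℚᵘ (ι (i ℤ.+ j))                    ≈⟨ toℚᵘ-ι (i ℤ.+ j) ⟩
    ℚᵘ.mkℚᵘ (i ℤ.+ j) 0                     ≡⟨ cong (λ k → ℚᵘ.mkℚᵘ k 0)
                                                 (cong₂ ℤ._+_ (ℤ.*-identityʳ i) (ℤ.*-identityʳ j)) ⟨
    ℚᵘ.mkℚᵘ i 0 ℚᵘ.+ ℚᵘ.mkℚᵘ j 0            ≈⟨ ℚᵘ.+-cong (toℚᵘ-ι i) (toℚᵘ-ι j) ⟨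
    ℚ.toℚᵘ (ι i) ℚᵘ.+ ℚ.toℚᵘ (ι j)          ≈⟨ ℚ.toℚᵘ-homo-+ (ι i) (ι j) ⟨
    ℚ.toℚᵘ (ι i + ι j)                      ∎)
    where open ℚᵘ.≃-Reasoning

  ι-neg : ∀ i → ι (ℤ.- i) ≡ - ι i
  ι-neg i = ℚ.toℚᵘ-injective (begin
    ℚ.toℚᵘ (ι (ℤ.- i))       ≈⟨ toℚᵘ-ι (ℤ.- i) ⟩
    ℚᵘ.- ℚᵘ.mkℚᵘ i 0         ≈⟨ ℚᵘ.-‿cong (toℚᵘ-ι i) ⟨
    ℚᵘ.- ℚ.toℚᵘ (ι i)        ≈⟨ ℚ.toℚᵘ-homo‿- (ι i) ⟨
    ℚ.toℚᵘ (- ι i)           ∎)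
    where open ℚᵘ.≃-Reasoning

  ι-mono-≤ : ∀ {i j} → i ℤ.≤ j → ι i ≤ ι j
  ι-mono-≤ {i} {j} i≤j = ℚ.toℚᵘ-cancel-≤ (begin
    ℚ.toℚᵘ (ι i)     ≃⟨ toℚᵘ-ι i ⟩
    ℚᵘ.mkℚᵘ i 0      ≤⟨ ℚᵘ.*≤* (ℤ.*-monoʳ-≤-nonNeg (+ 1) i≤j) ⟩
    ℚᵘ.mkℚᵘ j 0      ≃⟨ toℚᵘ-ι j ⟨
    ℚ.toℚᵘ (ι j)     ∎)
    where open ℚᵘ.≤-Reasoning

  ι-cancel-< : ∀ {i j} → ι i < ι j → i ℤ.< j
  ι-cancel-< {i} {j} h with i ℤ.<? j
  ... | yes i<j = i<j
  ... | no  i≮j = ⊥-elim (ℚ.<-irrefl refl (ℚ.<-≤-trans h (ι-mono-≤ (ℤ.≮⇒≥ i≮j))))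

-- Periodic sequences and their maxima.

module Periodicity where

  Periodic : ∀ {A : Set} → ℕ → (ℕ → A) → Set
  Periodic p f = ∀ n → f (n ℕ.+ p) ≡ f n

  periodic-* : ∀ {A : Set} {p} {f : ℕ → A} → Periodic p f → ∀ n k → f (n ℕ.+ k ℕ.* p) ≡ f n
  periodic-* {f = f} per n zero = cong f (ℕ.+-identityʳ n)
  periodic-* {p = p} {f} per n (suc k) = trans
    (cong f (trans (cong (n ℕ.+_) (ℕ.+-comm p (k ℕ.* p))) (sym (ℕ.+-assoc n (k ℕ.* p) p))))
    (trans (per (n ℕ.+ k ℕ.* p)) (periodic-* per n k))

  periodic-% : ∀ {A : Set} {p} .{{_ : ℕ.NonZero p}} {f : ℕ → A} → Periodic p f →
    ∀ n → f n ≡ f (n ℕ.% p)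
  periodic-% {p = p} {f} per n =
    trans (cong f (ℕ.m≡m%n+[m/n]*n n p)) (periodic-* per (n ℕ.% p) (n ℕ./ p))

  periodic-shift : ∀ {A : Set} {p} {f : ℕ → A} → Periodic p f → ∀ i → Periodic p (λ n → f (n ℕ.+ i))
  periodic-shift {p = p} {f} per i n = trans
    (cong f (trans (ℕ.+-assoc n p i) (trans (cong (n ℕ.+_) (ℕ.+-comm p i)) (sym (ℕ.+-assoc n i p)))))
    (per (n ℕ.+ i))

  maximum-below : ∀ (f : ℕ → ℚ) k → ∃[ m ] (∀ n → n ℕ.< k → f n ℚ.≤ f m)
  -- The index is not claimed to lie below `k`, so 0 serves as the default for the empty range.
  maximum-below f zero = 0 , λ _ ()
  maximum-below f (suc k) with maximum-below f k
  ... | m , f≤ with ℚ.≤-total (f k) (f m)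
  ...   | inj₁ fk≤fm = m , λ n n<1+k → case n n<1+k
    where
    case : ∀ n → n ℕ.< suc k → f n ℚ.≤ f m
    case n n<1+k with ℕ.m<1+n⇒m<n∨m≡n n<1+k
    ... | inj₁ n<k  = f≤ n n<k
    ... | inj₂ refl = fk≤fm
  ...   | inj₂ fm≤fk = k , λ n n<1+k → case n n<1+k
    where
    case : ∀ n → n ℕ.< suc k → f n ℚ.≤ f k
    case n n<1+k with ℕ.m<1+n⇒m<n∨m≡n n<1+k
    ... | inj₁ n<k  = ℚ.≤-trans (f≤ n n<k) fm≤fk
    ... | inj₂ refl = ℚ.≤-refl

  maximum : ∀ {p} .{{_ : ℕ.NonZero p}} {f : ℕ → ℚ} → Periodic p f →
    ∃[ m ] (∀ n → f n ℚ.≤ f m)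
  maximum {p} {f = f} per with maximum-below f p
  ... | m , f≤ = m , λ n → subst (ℚ._≤ f m) (sym (periodic-% per n)) (f≤ (n ℕ.% p) (ℕ.m%n<n n p))

-- Periodic sequences under an expanding second-order recurrence over ℚ.

module PeriodicOrbits where

  open import Data.Rational using (_+_; _*_; -_; _-_; _≤_; _<_; ∣_∣)
  open RationalArithmetic
  open Periodicity

  -- On an orbit of τ this is x - ⌊x⌋ for x = r₀ aₙ + r₁ aₙ₊₁, hence a number in [0, 1).
  recur : ℚ → ℚ → (ℕ → ℚ) → ℕ → ℚ
  recur q₀ q₁ c n = q₀ * c n + q₁ * c (suc n) + c (suc (suc n))

  -- |b + λ a|² when the roots -λ and -λ̄ of x² + q x + s² are complex.
  Q : ℚ → ℚ → ℚ → ℚ → ℚ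
  Q s q a b = s * s * (a * a) + q * (a * b) + b * b

  ≤1² : ∀ {x} → ∣ x ∣ ≤ 1ℚ → x * x ≤ 1ℚ
  ≤1² {x} h = ≤-by ≤⇒0≤ (ℚ.≤-trans (x≤∣x∣ x) h) ⊗ ≤⇒0≤ (ℚ.≤-trans (-x≤∣x∣ x) h)
    ∵ solve (x ∷ []) ℚ-ring

  -- Without the error e, one step multiplies `Q` by exactly s², and e adds a vector (0, e) of
  -- `Q`-norm |e|. Where the energy does not increase, the triangle inequality gives s √Q ≤ √Q +
  -- |e|; the certificate states this without square roots.
  Q-energy : ∀ {s q a b c} → 1ℚ < s → - (2ℚ * s) ≤ q → q ≤ 2ℚ * s →
    ∣ s * s * a + q * b + c ∣ ≤ 1ℚ → Q s q b c ≤ Q s q a b →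
    (s - 1ℚ) * (s - 1ℚ) * Q s q a b ≤ 1ℚ
  Q-energy {s} {q} {a} {b} {c} 1<s -2s≤q q≤2s ∣e∣≤1 Q′≤Q =
    ≤-by ≤⇒0≤ (≤1² ∣e∣≤1) ⊕ 0≤-cancel 0<s 0≤rhs ∵ split e ((s - 1ℚ) * (s - 1ℚ) * Q s q a b)
    where
    0<u : 0ℚ < s - 1ℚ
    0<u = <⇒0< 1<s
    0≤u : 0ℚ ≤ s - 1ℚ
    0≤u = ℚ.<⇒≤ 0<u
    0<s : 0ℚ < s
    0<s = ℚ.<-trans 0<1 1<s
    0≤s : 0ℚ ≤ s
    0≤s = ℚ.<⇒≤ 0<s
    e ℓ : ℚ
    e = s * s * a + q * b + c
    ℓ = s * s * a + ½ * q * b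
    split : ∀ e x → 1ℚ - x ≡ (1ℚ - e * e) + (e * e - x)
    split = solve-∀ ℚ-ring
    -- Completes the square in e after weighting the cross term 2eℓ by (s - 1) / s,
    -- the ratio that is sharp for a form of value 1 / (s - 1)².
    square : ∀ s q a b c → let
        e = s * s * a + q * b + c
        ℓ = s * s * a + ½ * q * b
        u = s - 1ℚ
        Qab = s * s * (a * a) + q * (a * b) + b * b
        Qbc = s * s * (b * b) + q * (b * c) + c * c in
      s * (e * e - u * u * Qab) - 0ℚ ≡
      s * u * (Qab - Qbc) + (s * e - u * ℓ) * (s * e - u * ℓ)
        + (u * u) * ((½ * (2ℚ * s - q)) * (½ * (q - - (2ℚ * s)))) * (b * b)
    square = solve-∀ ℚ-ring
    0≤rhs : 0ℚ ≤ s * (e * e - (s - 1ℚ) * (s - 1ℚ) * Q s q a b)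
    0≤rhs = ≤-by
      0≤s ⊗ 0≤u ⊗ ≤⇒0≤ Q′≤Q
        ⊕ 0≤x² (s * e - (s - 1ℚ) * ℓ)
        ⊕ (0≤u ⊗ 0≤u) ⊗ ((0≤½ ⊗ ≤⇒0≤ q≤2s) ⊗ (0≤½ ⊗ ≤⇒0≤ -2s≤q)) ⊗ 0≤x² b
      ∵ square s q a b c

  -- The worst case is |q| = 2 s with q a b negative, where `Q` equals (s |a| - |b|)²; this is at
  -- least (s - 1)² a² because |b| ≤ |a|. The sign of a b decides which bound on q is used.
  Q-lower : ∀ {s q a b} → 1ℚ < s → - (2ℚ * s) ≤ q → q ≤ 2ℚ * s → b * b ≤ a * a →
    (s - 1ℚ) * (s - 1ℚ) * (a * a) ≤ Q s q a b
  Q-lower {s} {q} {a} {b} 1<s -2s≤q q≤2s b²≤a² with ℚ.≤-total 0ℚ (a * b)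
  ... | inj₁ 0≤ab = ≤-by
    ≤⇒0≤ -2s≤q ⊗ 0≤ab ⊕ ≤⇒0≤ (ℚ.<⇒≤ 1<s) ⊗ (0≤x² (a - b) ⊕ ≤⇒0≤ b²≤a²) ⊕ 0≤x² (a - b)
    ∵ eq s q a b
    where
    eq : ∀ s q a b →
      (s * s * (a * a) + q * (a * b) + b * b) - (s - 1ℚ) * (s - 1ℚ) * (a * a) ≡
      (q - - (2ℚ * s)) * (a * b) + (s - 1ℚ) * ((a - b) * (a - b) + (a * a - b * b))
        + (a - b) * (a - b)
    eq = solve-∀ ℚ-ring
  ... | inj₂ ab≤0 = ≤-by
    ≤⇒0≤ q≤2s ⊗ ≤⇒0≤ ab≤0 ⊕ ≤⇒0≤ (ℚ.<⇒≤ 1<s) ⊗ (0≤x² (a + b) ⊕ ≤⇒0≤ b²≤a²) ⊕ 0≤x² (a + b)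
    ∵ eq s q a b
    where
    eq : ∀ s q a b →
      (s * s * (a * a) + q * (a * b) + b * b) - (s - 1ℚ) * (s - 1ℚ) * (a * a) ≡
      (2ℚ * s - q) * (0ℚ - a * b) + (s - 1ℚ) * ((a + b) * (a + b) + (a * a - b * b))
        + (a + b) * (a + b)
    eq = solve-∀ ℚ-ring

  -- The energy and |c| may peak at different indices `l` and `k`. With U = (s - 1)², the chain is
  -- U² c(k)² ≤ U E(k) ≤ U E(l) ≤ 1.
  bound-complex : ∀ {p} .{{_ : ℕ.NonZero p}} {c : ℕ → ℚ} {s q} → Periodic p c →
    1ℚ < s → ½ < (s - 1ℚ) * (s - 1ℚ) → - (2ℚ * s) ≤ q → q ≤ 2ℚ * s →
    (∀ n → ∣ recur (s * s) q c n ∣ ≤ 1ℚ) → ∀ n → c n < 2ℚ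
  bound-complex {c = c} {s} {q} per 1<s ½<u² -2s≤q q≤2s ∣e∣≤1 n = ℚ.≰⇒> λ 2≤cn →
    ℚ.<-irrefl refl (ℚ.≤-<-trans u²c²u²≤1 (1<u²c²u² 2≤cn))
    where
    C : ℕ → ℚ
    C n = c n * c n
    E : ℕ → ℚ
    E n = Q s q (c n) (c (suc n))
    U : ℚ
    U = (s - 1ℚ) * (s - 1ℚ)
    maxC = maximum {f = C} (λ n → cong (λ x → x * x) (per n))
    maxE = maximum {f = E} (λ n → cong₂ (Q s q) (per n) (per (suc n)))
    k = proj₁ maxC
    l = proj₁ maxE
    0≤U : 0ℚ ≤ U
    0≤U = 0≤x² (s - 1ℚ)
    u²c²u²≤1 : U * (U * C k) ≤ 1ℚ
    u²c²u²≤1 = ≤-by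
      ≤⇒0≤ (Q-energy 1<s -2s≤q q≤2s (∣e∣≤1 l) (proj₂ maxE (suc l)))
        ⊕ 0≤U ⊗ ≤⇒0≤ (proj₂ maxE k)
        ⊕ 0≤U ⊗ ≤⇒0≤ (Q-lower {s} {q} {c k} {c (suc k)} 1<s -2s≤q q≤2s (proj₂ maxC (suc k)))
      ∵ eq U (E l) (E k) (C k)
      where
      eq : ∀ u x y z → 1ℚ - u * (u * z) ≡ (1ℚ - u * x) + u * (x - y) + u * (y - u * z)
      eq = solve-∀ ℚ-ring
    1<u²c²u² : 2ℚ ≤ c n → 1ℚ < U * (U * C k)
    -- c(n) ≥ 2 forces C(k) ≥ 4, while U > 1/2 gives U² > 1/4, so the product exceeds 1.
    1<u²c²u² 2≤cn = <-by
      0≤U ⊗ 0≤U ⊗ (≤⇒0≤ (proj₂ maxC n) ⊕ ≤⇒0≤ 2≤cn ⊗ (≤⇒0≤ 2≤cn ⊕ 0≤2 ⊕ 0≤2))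
        ⊕< (0<4 ⊗< (<⇒0< ½<u² ⊗< (<⇒0< ½<u² ⊕<′ 0≤1)))
      ∵ eq U (C k) (c n)
      where
      0<4 : 0ℚ < 2ℚ + 2ℚ
      0<4 = ℚ.positive⁻¹ _
      _⊕<′_ : ∀ {x y} → 0ℚ < x → 0ℚ ≤ y → 0ℚ < x + y
      _⊕<′_ = ℚ.+-mono-<-≤
      eq : ∀ u z x → u * (u * z) - 1ℚ ≡
        u * u * ((z - x * x) + (x - 2ℚ) * ((x - 2ℚ) + 2ℚ + 2ℚ)) + (2ℚ + 2ℚ) * ((u - ½) * ((u - ½) + 1ℚ))
      eq = solve-∀ ℚ-ring

  -- At an index k where |f| is largest, m |f(k)| ≤ E + |f(k + 1)| ≤ E + |f(k)|.
  expansion : ∀ {p} .{{_ : ℕ.NonZero p}} {f : ℕ → ℚ} {m E} → Periodic p f → 1ℚ ≤ m →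
    (∀ n → ∣ f (suc n) + m * f n ∣ ≤ E) → ∀ n → (m - 1ℚ) * ∣ f n ∣ ≤ E
  expansion {f = f} {m} {E} per 1≤m h n with maximum {f = λ n → ∣ f n ∣} (λ n → cong ∣_∣ (per n))
  ... | k , ≤k = ≤-by ≤⇒0≤ 1≤m ⊗ ≤⇒0≤ (≤k n) ⊕ ≤⇒0≤ m∣fk∣≤ ∵ eq m (∣ f n ∣) (∣ f k ∣) E
    where
    eq : ∀ m x y e → e - (m - 1ℚ) * x ≡ (m - 1ℚ) * (y - x) + ((e + y) - m * y)
    eq = solve-∀ ℚ-ring
    shuffle : ∀ x y → y ≡ (x + y) - x
    shuffle = solve-∀ ℚ-ring
    m∣fk∣≤ : m * ∣ f k ∣ ≤ E + ∣ f k ∣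
    m∣fk∣≤ = begin
      m * ∣ f k ∣                                        ≡⟨ cong (_* ∣ f k ∣) (ℚ.0≤p⇒∣p∣≡p (ℚ.≤-trans 0≤1 1≤m)) ⟨
      ∣ m ∣ * ∣ f k ∣                                    ≡⟨ ℚ.∣p*q∣≡∣p∣*∣q∣ m (f k) ⟨
      ∣ m * f k ∣                                        ≡⟨ cong ∣_∣ (shuffle (f (suc k)) (m * f k)) ⟩
      ∣ (f (suc k) + m * f k) - f (suc k) ∣              ≤⟨ ℚ.∣p-q∣≤∣p∣+∣q∣ (f (suc k) + m * f k) (f (suc k)) ⟩
      ∣ f (suc k) + m * f k ∣ + ∣ f (suc k) ∣            ≤⟨ ℚ.+-mono-≤ (h k) (≤k (suc k)) ⟩
      E + ∣ f k ∣                                        ∎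
      where open ℚ.≤-Reasoning

  -- The real roots need not be known: μ = q / 2 works for both factors, as μ² ≥ s² and
  -- (μ - 1)² - (μ² - s²) = s² - q + 1 > 1/2.
  bound-real : ∀ {p} .{{_ : ℕ.NonZero p}} {c : ℕ → ℚ} {s q} → Periodic p c →
    1ℚ < s → 2ℚ * s ≤ q → q < s * s + ½ →
    (∀ n → ∣ recur (s * s) q c n ∣ ≤ 1ℚ) → ∀ n → c n < 2ℚ
  bound-real {c = c} {s} {q} per 1<s 2s≤q q<s²+½ ∣e∣≤1 n = ℚ.≰⇒> λ 2≤cn →
    ℚ.<-irrefl refl (ℚ.<-≤-trans (<-by
      (0≤½ ⊗ (≤⇒0≤ (≤k n) ⊕ ≤⇒0≤ (x≤∣x∣ (c n)) ⊕ ≤⇒0≤ 2≤cn))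
        ⊕< (<⇒0< q<s²+½ ⊗< ℚ.<-≤-trans 0<2 (ℚ.≤-trans 2≤cn (ℚ.≤-trans (x≤∣x∣ (c n)) (≤k n))))
      ∵ eq₂ s q C (∣ c n ∣) (c n)) contracted)
    where
    0<2 : 0ℚ < 2ℚ
    0<2 = ℚ.positive⁻¹ _
    m : ℚ
    m = ½ * q
    maxC = maximum {f = λ n → ∣ c n ∣} (λ n → cong ∣_∣ (per n))
    k = proj₁ maxC
    ≤k = proj₂ maxC
    C : ℚ
    C = ∣ c k ∣
    s≤m : s ≤ m
    s≤m = ≤-by 0≤½ ⊗ ≤⇒0≤ 2s≤q ∵ eq s q
      where
      eq : ∀ s q → ½ * q - s ≡ ½ * (q - 2ℚ * s)
      eq = solve-∀ ℚ-ring
    1≤m : 1ℚ ≤ m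
    1≤m = ℚ.≤-trans (ℚ.<⇒≤ 1<s) s≤m
    0≤s : 0ℚ ≤ s
    0≤s = ℚ.<⇒≤ (ℚ.<-trans 0<1 1<s)
    d : ℚ
    d = m * m - s * s
    0≤d : 0ℚ ≤ d
    0≤d = ≤-by ≤⇒0≤ s≤m ⊗ (≤⇒0≤ s≤m ⊕ 0≤s ⊕ 0≤s) ∵ eq m s
      where
      eq : ∀ m s → (m * m - s * s) - 0ℚ ≡ (m - s) * ((m - s) + s + s)
      eq = solve-∀ ℚ-ring
    -- Applying the factor x + m twice gives x² + q x + m², so `b` meets a first-order recurrence up
    -- to the original error and `d * c n`; the latter accounts for `d * C` in `E`.
    b : ℕ → ℚ
    b n = c (suc n) + m * c n
    b-per : Periodic _ b
    b-per n = cong₂ (λ x y → x + m * y) (per (suc n)) (per n)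
    E : ℚ
    E = 1ℚ + d * C
    ∣b′+mb∣≤E : ∀ n → ∣ b (suc n) + m * b n ∣ ≤ E
    ∣b′+mb∣≤E n = begin
      ∣ b (suc n) + m * b n ∣
        ≡⟨ cong ∣_∣ (eq s q (c n) (c (suc n)) (c (suc (suc n)))) ⟩
      ∣ recur (s * s) q c n + d * c n ∣
        ≤⟨ ℚ.∣p+q∣≤∣p∣+∣q∣ (recur (s * s) q c n) (d * c n) ⟩
      ∣ recur (s * s) q c n ∣ + ∣ d * c n ∣
        ≡⟨ cong (λ x → ∣ recur (s * s) q c n ∣ + x)
             (trans (ℚ.∣p*q∣≡∣p∣*∣q∣ d (c n)) (cong (_* ∣ c n ∣) (ℚ.0≤p⇒∣p∣≡p 0≤d))) ⟩
      ∣ recur (s * s) q c n ∣ + d * ∣ c n ∣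
        ≤⟨ ℚ.+-mono-≤ (∣e∣≤1 n) (ℚ.*-monoˡ-≤-nonNeg d {{ℚ.nonNegative 0≤d}} (≤k n)) ⟩
      E ∎
      where
      open ℚ.≤-Reasoning
      eq : ∀ s q x y z → (z + ½ * q * y) + ½ * q * (y + ½ * q * x)
        ≡ (s * s * x + q * y + z) + ((½ * q) * (½ * q) - s * s) * x
      eq = solve-∀ ℚ-ring
    ∣b∣ : ∀ n → (m - 1ℚ) * ∣ b n ∣ ≤ E
    ∣b∣ n = expansion b-per 1≤m ∣b′+mb∣≤E n
    0≤m-1 : 0ℚ ≤ m - 1ℚ
    0≤m-1 = ≤⇒0≤ 1≤m
    scale : ∀ x → ∣ (m - 1ℚ) * x ∣ ≡ (m - 1ℚ) * ∣ x ∣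
    scale x = trans (ℚ.∣p*q∣≡∣p∣*∣q∣ (m - 1ℚ) x) (cong (_* ∣ x ∣) (ℚ.0≤p⇒∣p∣≡p 0≤m-1))
    -- Rescaling `c` lets the bound on (m - 1) |b| be used as it stands, without division. The
    -- outcome is (m - 1)² C ≤ 1 + d C, and `contracted` moves d C to the left.
    f : ℕ → ℚ
    f n = (m - 1ℚ) * c n
    ∣f′+mf∣≤E : ∀ n → ∣ f (suc n) + m * f n ∣ ≤ E
    ∣f′+mf∣≤E n = subst (_≤ E) (trans (sym (scale (b n))) (cong ∣_∣ (eq m (c n) (c (suc n))))) (∣b∣ n)
      where
      eq : ∀ m x y → (m - 1ℚ) * (y + m * x) ≡ (m - 1ℚ) * y + m * ((m - 1ℚ) * x)
      eq = solve-∀ ℚ-ring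
    contracted : (s * s - q + 1ℚ) * C ≤ 1ℚ
    contracted = ≤-by
      ≤⇒0≤ (subst (λ x → (m - 1ℚ) * x ≤ E) (scale (c k))
        (expansion (λ n → cong ((m - 1ℚ) *_) (per n)) 1≤m ∣f′+mf∣≤E k))
      ∵ eq s q C
      where
      eq : ∀ s q x → 1ℚ - (s * s - q + 1ℚ) * x ≡
        (1ℚ + ((½ * q) * (½ * q) - s * s) * x) - (½ * q - 1ℚ) * ((½ * q - 1ℚ) * x)
      eq = solve-∀ ℚ-ring
    eq₂ : ∀ s q z y x → (s * s - q + 1ℚ) * z - 1ℚ ≡
      ½ * ((z - y) + (y - x) + (x - 2ℚ)) + ((s * s + ½) - q) * z
    eq₂ = solve-∀ ℚ-ring

  bound : ∀ {p} .{{_ : ℕ.NonZero p}} {c : ℕ → ℚ} {s q} → Periodic p c →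
    1ℚ < s → ½ < (s - 1ℚ) * (s - 1ℚ) → - (2ℚ * s) ≤ q → q < s * s + ½ →
    (∀ n → ∣ recur (s * s) q c n ∣ ≤ 1ℚ) → ∀ n → c n < 2ℚ
  bound {s = s} {q} per 1<s ½<u² -2s≤q q<s²+½ ∣e∣≤1 with ℚ.≤-total q (2ℚ * s)
  ... | inj₁ q≤2s = bound-complex per 1<s ½<u² -2s≤q q≤2s ∣e∣≤1
  ... | inj₂ 2s≤q = bound-real per 1<s 2s≤q q<s²+½ ∣e∣≤1

  -- If b₀ ≥ 1 then b ≥ 0, and b cannot fall from a positive value to 0 because q₀ ≥ 1.
  -- So b ≥ 1 throughout, which is impossible at a maximum of b.
  nonpositive-head : ∀ {p} .{{_ : ℕ.NonZero p}} {b : ℕ → ℤ} {q₀ q₁} → Periodic p b →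
    1ℚ ≤ q₀ → 0ℚ ≤ q₀ + q₁ → (∀ n → recur q₀ q₁ (λ n → ι (b n)) n < 1ℚ) →
    (∀ i j → ι (b i) - ι (b j) < 2ℚ) → b 0 ℤ.≤ + 0
  nonpositive-head {b = b} {q₀} {q₁} per 1≤q₀ 0≤q₀+q₁ e<1 narrow = ℤ.≮⇒≥ absurd
    where
    β : ℕ → ℚ
    β n = ι (b n)
    0≤β-1 : ∀ {n} → + 0 ℤ.< b n → 0ℚ ≤ β n - 1ℚ
    0≤β-1 0<bn = ≤⇒0≤ (ι-mono-≤ (ℤ.i<j⇒suc[i]≤j 0<bn))
    0≤q₀-1 : 0ℚ ≤ q₀ - 1ℚ
    0≤q₀-1 = ≤⇒0≤ 1≤q₀
    refute : ∀ n → ¬ (1ℚ ≤ recur q₀ q₁ β n)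
    refute n 1≤e = ℚ.<-irrefl refl (ℚ.<-≤-trans (e<1 n) 1≤e)
    absurd : ¬ (+ 0 ℤ.< b 0)
    absurd 0<b₀ = go (ℚ.≤-total 0ℚ q₁)
      where
      -1<β : ∀ n → ι (ℤ.- (+ 1)) < β n
      -1<β n = <-by 0≤β-1 0<b₀ ⊕< <⇒0< (narrow 0 n) ∵ eq (β 0) (β n)
        where
        eq : ∀ x y → y - - 1ℚ ≡ (x - 1ℚ) + (2ℚ - (x - y))
        eq = solve-∀ ℚ-ring
      0≤b : ∀ n → + 0 ℤ.≤ b n
      0≤b n = ℤ.i<j⇒suc[i]≤j (ι-cancel-< {ℤ.- (+ 1)} (-1<β n))
      0≤β : ∀ n → 0ℚ ≤ β n
      0≤β n = ι-mono-≤ (0≤b n)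
      stays : ∀ n → + 0 ℤ.< b n → + 0 ℤ.< b (suc n)
      stays n 0<bn = ℤ.≰⇒> λ b≤0 → refute n
        (subst (λ i → 1ℚ ≤ q₀ * β n + q₁ * ι i + β (suc (suc n)))
          (ℤ.≤-antisym (0≤b (suc n)) b≤0)
          (≤-by 0≤q₀-1 ⊗ 0≤β-1 0<bn ⊕ 0≤q₀-1 ⊕ 0≤β-1 0<bn ⊕ 0≤β (suc (suc n))
            ∵ eq q₀ q₁ (β n) (β (suc (suc n)))))
        where
        eq : ∀ q₀ q₁ x z → (q₀ * x + q₁ * 0ℚ + z) - 1ℚ ≡
          (q₀ - 1ℚ) * (x - 1ℚ) + (q₀ - 1ℚ) + (x - 1ℚ) + z
        eq = solve-∀ ℚ-ring
      0<b : ∀ n → + 0 ℤ.< b n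
      0<b zero    = 0<b₀
      0<b (suc n) = stays n (0<b n)
      -- If q₁ ≥ 0, the term q₀ β(0) is already at least 1 and the others are nonnegative. If q₁ ≤
      -- 0, then at a maximum k the first two terms add up to at least (q₀ + q₁) β(k) ≥ 0, and the
      -- third is at least 1.
      go : 0ℚ ≤ q₁ ⊎ q₁ ≤ 0ℚ → ⊥
      go (inj₁ 0≤q₁) = refute 0 (≤-by
        0≤q₀-1 ⊗ 0≤β-1 0<b₀ ⊕ 0≤q₀-1 ⊕ 0≤β-1 0<b₀ ⊕ 0≤q₁ ⊗ 0≤β 1 ⊕ 0≤β 2
        ∵ eq q₀ q₁ (β 0) (β 1) (β 2))
        where
        eq : ∀ q₀ q₁ x y z → (q₀ * x + q₁ * y + z) - 1ℚ ≡
          (q₀ - 1ℚ) * (x - 1ℚ) + (q₀ - 1ℚ) + (x - 1ℚ) + q₁ * y + z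
        eq = solve-∀ ℚ-ring
      go (inj₂ q₁≤0) with maximum {f = β} (λ n → cong ι (per n))
      ... | k , ≤βk = refute k (≤-by
        0≤q₀+q₁ ⊗ 0≤β k ⊕ ≤⇒0≤ q₁≤0 ⊗ ≤⇒0≤ (≤βk (suc k)) ⊕ 0≤β-1 (0<b (suc (suc k)))
        ∵ eq q₀ q₁ (β k) (β (suc k)) (β (suc (suc k))))
        where
        eq : ∀ q₀ q₁ x y z → (q₀ * x + q₁ * y + z) - 1ℚ ≡
          (q₀ + q₁) * x + (0ℚ - q₁) * (x - y) + (z - 1ℚ)
        eq = solve-∀ ℚ-ring

  nonpositive : ∀ {p} .{{_ : ℕ.NonZero p}} {b : ℕ → ℤ} {q₀ q₁} → Periodic p b →
    1ℚ ≤ q₀ → 0ℚ ≤ q₀ + q₁ → (∀ n → recur q₀ q₁ (λ n → ι (b n)) n < 1ℚ) →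
    (∀ i j → ι (b i) - ι (b j) < 2ℚ) → ∀ n → b n ℤ.≤ + 0
  nonpositive per 1≤q₀ 0≤q₀+q₁ e<1 narrow n = nonpositive-head (periodic-shift per n) 1≤q₀ 0≤q₀+q₁
    (λ m → e<1 (m ℕ.+ n)) (λ i j → narrow (i ℕ.+ n) (j ℕ.+ n))

  -- Perturbation destroys e ∈ [0, 1), so only the open interval (-1, 1) and a spread of at most 1
  -- are assumed. The spread controls differences of shifts of `b`; the two ends of the interval
  -- serve the sign argument for `b` and for its negative.
  periodic⇒zero : ∀ {p} .{{_ : ℕ.NonZero p}} {b : ℕ → ℤ} {s q} → Periodic p b →
    1ℚ < s → ½ < (s - 1ℚ) * (s - 1ℚ) →
    - (2ℚ * s) ≤ q → - (s * s) ≤ q → q < s * s + ½ →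
    (let e = recur (s * s) q (λ n → ι (b n))) →
    (∀ n → e n < 1ℚ) → (∀ n → - 1ℚ < e n) → (∀ m n → e m - e n ≤ 1ℚ) →
    ∀ n → b n ≡ + 0
  periodic⇒zero {p} {b} {s} {q} per 1<s ½<u² -2s≤q -s²≤q q<s²+½ e<1 -1<e spread n =
    ℤ.≤-antisym
      (nonpositive per 1≤s² 0≤s²+q e<1 narrow n)
      (ℤ.neg-cancel-≤ (nonpositive {b = λ n → ℤ.- b n} (λ n → cong ℤ.-_ (per n)) 1≤s² 0≤s²+q -e<1
        (λ i j → subst (_< 2ℚ) (flip i j) (narrow j i)) n))
    where
    β : ℕ → ℚ
    β n = ι (b n)
    1≤s² : 1ℚ ≤ s * s
    1≤s² = ≤-by 0≤s-1 ⊗ (0≤s-1 ⊕ 0≤2) ∵ solve (s ∷ []) ℚ-ring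
      where
      0≤s-1 : 0ℚ ≤ s - 1ℚ
      0≤s-1 = ≤⇒0≤ (ℚ.<⇒≤ 1<s)
    0≤s²+q : 0ℚ ≤ s * s + q
    0≤s²+q = ≤-by ≤⇒0≤ -s²≤q ∵ solve (s ∷ q ∷ []) ℚ-ring
    narrow : ∀ i j → β i - β j < 2ℚ
    narrow i j = bound {c = λ n → β (n ℕ.+ i) - β (n ℕ.+ j)} diff-per 1<s ½<u² -2s≤q q<s²+½ ∣e∣≤1 0
      where
      diff-per : Periodic p (λ n → β (n ℕ.+ i) - β (n ℕ.+ j))
      diff-per n = cong₂ (λ k l → ι k - ι l) (periodic-shift per i n) (periodic-shift per j n)
      ∣e∣≤1 : ∀ n → ∣ recur (s * s) q (λ n → β (n ℕ.+ i) - β (n ℕ.+ j)) n ∣ ≤ 1ℚ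
      ∣e∣≤1 n = ∣x∣≤
        (≤-by ≤⇒0≤ (spread (n ℕ.+ i) (n ℕ.+ j))
          ∵ eq₁ (s * s) q (β (n ℕ.+ i)) (β (suc n ℕ.+ i)) (β (suc (suc n) ℕ.+ i))
              (β (n ℕ.+ j)) (β (suc n ℕ.+ j)) (β (suc (suc n) ℕ.+ j)))
        (≤-by ≤⇒0≤ (spread (n ℕ.+ j) (n ℕ.+ i))
          ∵ eq₂ (s * s) q (β (n ℕ.+ i)) (β (suc n ℕ.+ i)) (β (suc (suc n) ℕ.+ i))
              (β (n ℕ.+ j)) (β (suc n ℕ.+ j)) (β (suc (suc n) ℕ.+ j)))
        where
        eq₁ : ∀ q₀ q₁ x y z x′ y′ z′ →
          1ℚ - (q₀ * (x - x′) + q₁ * (y - y′) + (z - z′)) ≡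
          1ℚ - ((q₀ * x + q₁ * y + z) - (q₀ * x′ + q₁ * y′ + z′))
        eq₁ = solve-∀ ℚ-ring
        eq₂ : ∀ q₀ q₁ x y z x′ y′ z′ →
          1ℚ - - (q₀ * (x - x′) + q₁ * (y - y′) + (z - z′)) ≡
          1ℚ - ((q₀ * x′ + q₁ * y′ + z′) - (q₀ * x + q₁ * y + z))
        eq₂ = solve-∀ ℚ-ring
    -e<1 : ∀ n → recur (s * s) q (λ n → ι (ℤ.- b n)) n < 1ℚ
    -e<1 n rewrite ι-neg (b n) | ι-neg (b (suc n)) | ι-neg (b (suc (suc n))) =
      <-by <⇒0< (-1<e n) ∵ eq (s * s) q (β n) (β (suc n)) (β (suc (suc n)))
      where
      eq : ∀ q₀ q₁ x y z → 1ℚ - (q₀ * (- x) + q₁ * (- y) + (- z)) ≡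
        (q₀ * x + q₁ * y + z) - - 1ℚ
      eq = solve-∀ ℚ-ring
    flip : ∀ i j → ι (b j) - ι (b i) ≡ ι (ℤ.- b i) - ι (ℤ.- b j)
    flip i j = trans (eq (ι (b i)) (ι (b j))) (sym (cong₂ _-_ (ι-neg (b i)) (ι-neg (b j))))
      where
      eq : ∀ x y → y - x ≡ - x - - y
      eq = solve-∀ ℚ-ring

-- Stability under rational approximation of the parameters.

module Perturbation where

  open import Data.Rational using (_+_; _*_; -_; _-_; _≤_; _<_; ∣_∣; _⊔_)
  open RationalArithmetic
  open Periodicity
  open PeriodicOrbits

  3/2 : ℚ
  3/2 = + 3 ℚ./ 2

  0<-cancel : ∀ {k x} → 0ℚ < k → 0ℚ < k * x → 0ℚ < x
  0<-cancel {k} {x} 0<k 0<kx = ℚ.*-cancelˡ-<-nonNeg k {{ℚ.nonNegative (ℚ.<⇒≤ 0<k)}}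
    (subst (_< k * x) (sym (ℚ.*-zeroʳ k)) 0<kx)

  -- With y = σ² - 3/2 one has y² - 2 = ((σ - 1)² - 1/2) (σ² + 2σ + 1/2), so y > √2
  -- amounts to (σ - 1)² > 1/2.
  module ApproximateRoots (σ ρ₀ w δ : ℚ) (0<δ : 0ℚ < δ) (δ≤½ : δ ≤ ½)
    (σ²≈ρ₀ : ∣ σ * σ - ρ₀ ∣ ≤ δ) (0≤σ+δ : 0ℚ ≤ σ + δ)
    (w²≈2 : ∣ w * w - 2ℚ ∣ ≤ δ) (0≤w+δ : 0ℚ ≤ w + δ)
    (gap : 3/2 + w + (δ + δ + δ + δ) ≤ ρ₀) where

    0≤δ : 0ℚ ≤ δ
    0≤δ = ℚ.<⇒≤ 0<δ

    w²≥2-δ : 0ℚ ≤ δ - (2ℚ - w * w)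
    w²≥2-δ = ≤-by ≤⇒0≤ (ℚ.≤-trans (-x≤∣x∣ (w * w - 2ℚ)) w²≈2) ∵ solve (w ∷ δ ∷ []) ℚ-ring

    -- An approximate root is known only to be at least -δ ≥ -1/2. This makes w + 1 positive, and
    -- dividing w² - 1 ≥ 0 by it settles the sign; `1<σ` proceeds likewise.
    0≤w-1 : 0ℚ ≤ w - 1ℚ
    0≤w-1 = 0≤-cancel {w + 1ℚ}
      (<-by (0≤w+δ ⊕ ≤⇒0≤ δ≤½) ⊕< 0<½ ∵ solve (w ∷ δ ∷ []) ℚ-ring)
      (≤-by w²≥2-δ ⊕ ≤⇒0≤ δ≤½ ⊕ 0≤½ ∵ solve (w ∷ δ ∷ []) ℚ-ring)

    σ²-gap : 0ℚ ≤ (σ * σ - 3/2) - (w + (δ + δ + δ))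
    σ²-gap = ≤-by ≤⇒0≤ gap ⊕ ≤⇒0≤ (ℚ.≤-trans (-x≤∣x∣ (σ * σ - ρ₀)) σ²≈ρ₀)
      ∵ solve (σ ∷ w ∷ ρ₀ ∷ δ ∷ []) ℚ-ring

    1<σ : 1ℚ < σ
    1<σ = <-by 0<-cancel {σ + 1ℚ}
      (<-by (0≤σ+δ ⊕ ≤⇒0≤ δ≤½) ⊕< 0<½ ∵ solve (σ ∷ δ ∷ []) ℚ-ring)
      (<-by (σ²-gap ⊕ 0≤w-1 ⊕ 0≤δ ⊕ 0≤δ ⊕ 0≤δ ⊕ 0≤½) ⊕< 0<1 ∵ eq σ w δ)
      ∵ refl
      where
      eq : ∀ σ w δ → (σ + 1ℚ) * (σ - 1ℚ) - 0ℚ ≡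
        (σ * σ - 3/2) - (w + (δ + δ + δ)) + (w - 1ℚ) + δ + δ + δ + ½ + 1ℚ
      eq = solve-∀ ℚ-ring

    0<σ : 0ℚ < σ
    0<σ = ℚ.<-trans 0<1 1<σ

    ½<[σ-1]² : ½ < (σ - 1ℚ) * (σ - 1ℚ)
    ½<[σ-1]² = <-by 0<-cancel {σ * σ + ½ + (σ + σ)}
      ((0≤x² σ ⊕ 0≤½) ⊕< (ℚ.<⇒≤ 0<σ ⊕< 0<σ))
      -- w² may fall short of 2 by δ, but σ² - 3/2 exceeds w by at least 3δ, which contributes 6δ w
      -- ≥ 6δ to the square; 5δ remains.
      (<-by
        (σ²-gap ⊗ (σ²-gap ⊕ 0≤w+3δ ⊕ 0≤w+3δ) ⊕ w²≥2-δ ⊕ (0≤6δ ⊗ 0≤w-1) ⊕ 0≤x² (δ + δ + δ)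
          ⊕ 0≤δ ⊕ 0≤δ ⊕ 0≤δ ⊕ 0≤δ)
          ⊕< 0<δ
        ∵ factor σ w δ)
      ∵ solve (σ ∷ []) ℚ-ring
      where
      0≤3δ : 0ℚ ≤ δ + δ + δ
      0≤3δ = 0≤δ ⊕ 0≤δ ⊕ 0≤δ
      0≤6δ : 0ℚ ≤ (δ + δ + δ) + (δ + δ + δ)
      0≤6δ = 0≤3δ ⊕ 0≤3δ
      0≤w+3δ : 0ℚ ≤ (w - 1ℚ) + 1ℚ + (δ + δ + δ)
      0≤w+3δ = 0≤w-1 ⊕ 0≤1 ⊕ 0≤3δ
      factor : ∀ σ w δ → let
          t = δ + δ + δ
          g = (σ * σ - 3/2) - (w + t) in
        (σ * σ + ½ + (σ + σ)) * (σ * σ + ½ - (σ + σ)) - 0ℚ ≡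
        g * (g + ((w - 1ℚ) + 1ℚ + t) + ((w - 1ℚ) + 1ℚ + t)) + (δ - (2ℚ - w * w))
          + (t + t) * (w - 1ℚ) + t * t + δ + δ + δ + δ + δ
      factor = solve-∀ ℚ-ring

  -- Weak inequalities and equations between reals survive in late terms only up to δ, while strict
  -- ones keep a margin γ. Replacing ρ₀, ρ₁ by σ², `q` makes the weak ones exact and moves each
  -- recurrence value by at most 3Kδ, which γ absorbs.
  perturbed⇒zero : ∀ {p} .{{_ : ℕ.NonZero p}} {b : ℕ → ℤ} {σ ρ₀ ρ₁ w γ δ K} → Periodic p b →
    0ℚ < δ → 0ℚ ≤ K → (2ℚ + 2ℚ + (K + K + K) + (K + K + K)) * δ ≡ γ → γ ≤ ½ →
    (∀ n → ∣ ι (b n) ∣ ≤ K) →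
    ∣ σ * σ - ρ₀ ∣ ≤ δ → 0ℚ ≤ σ + δ →
    ∣ w * w - 2ℚ ∣ ≤ δ → 0ℚ ≤ w + δ →
    -½ + γ ≤ ρ₀ - ρ₁ →
    - (2ℚ * σ) ⊔ - ρ₀ ≤ ρ₁ + δ →
    3/2 + w + γ ≤ ρ₀ →
    (∀ n → 0ℚ ≤ recur ρ₀ ρ₁ (λ n → ι (b n)) n + δ) →
    (∀ n → recur ρ₀ ρ₁ (λ n → ι (b n)) n + γ ≤ 1ℚ) →
    ∀ n → b n ≡ + 0
  perturbed⇒zero {b = b} {σ} {ρ₀} {ρ₁} {w} {_} {δ} {K} per 0<δ 0≤K refl γ≤½ ∣b∣≤K
    σ²≈ρ₀ 0≤σ+δ w²≈2 0≤w+δ diff lower gap 0≤e+δ e+γ≤1 =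
    periodic⇒zero {q = q} per 1<σ ½<[σ-1]² -2σ≤q -σ²≤q q<σ²+½ e<1 -1<e spread
    where
    β : ℕ → ℚ
    β n = ι (b n)
    0≤δ : 0ℚ ≤ δ
    0≤δ = ℚ.<⇒≤ 0<δ
    0≤3Kδ : 0ℚ ≤ (K + K + K) * δ
    0≤3Kδ = (0≤K ⊕ 0≤K ⊕ 0≤K) ⊗ 0≤δ
    δ≤½ : δ ≤ ½
    δ≤½ = ≤-by ≤⇒0≤ γ≤½ ⊕ 0≤3Kδ ⊕ 0≤3Kδ ⊕ 0≤δ ⊕ 0≤δ ⊕ 0≤δ ∵ eq K δ
      where
      eq : ∀ K δ → ½ - δ ≡ (½ - (2ℚ + 2ℚ + (K + K + K) + (K + K + K)) * δ)
        + (K + K + K) * δ + (K + K + K) * δ + δ + δ + δ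
      eq = solve-∀ ℚ-ring
    gap′ : 3/2 + w + (δ + δ + δ + δ) ≤ ρ₀
    gap′ = ≤-by ≤⇒0≤ gap ⊕ 0≤3Kδ ⊕ 0≤3Kδ ∵ eq w K δ ρ₀
      where
      eq : ∀ w K δ ρ₀ → ρ₀ - (3/2 + w + (δ + δ + δ + δ)) ≡
        ρ₀ - (3/2 + w + (2ℚ + 2ℚ + (K + K + K) + (K + K + K)) * δ) + (K + K + K) * δ + (K + K + K) * δ
      eq = solve-∀ ℚ-ring
    open ApproximateRoots σ ρ₀ w δ 0<δ δ≤½ σ²≈ρ₀ 0≤σ+δ w²≈2 0≤w+δ gap′ using (1<σ; 0<σ; ½<[σ-1]²)
    -- Raising ρ₁ to q costs at most 2δ and makes the two weak inequalities exact.
    m q : ℚ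
    m = - (2ℚ * σ) ⊔ - (σ * σ)
    q = ρ₁ ⊔ m
    -2σ≤q : - (2ℚ * σ) ≤ q
    -2σ≤q = ℚ.≤-trans (ℚ.p≤p⊔q (- (2ℚ * σ)) (- (σ * σ))) (ℚ.p≤q⊔p ρ₁ m)
    -σ²≤q : - (σ * σ) ≤ q
    -σ²≤q = ℚ.≤-trans (ℚ.p≤q⊔p (- (2ℚ * σ)) (- (σ * σ))) (ℚ.p≤q⊔p ρ₁ m)
    q<σ²+½ : q < σ * σ + ½
    -- `ℚ.⊔-lub` yields only a weak bound, so each part of the maximum is compared with the target
    -- lowered by δ.
    q<σ²+½ = ℚ.≤-<-trans
      (ℚ.⊔-lub ρ₁≤ (ℚ.⊔-lub
        (≤-by 0≤x² σ ⊕ 0≤2 ⊗ ℚ.<⇒≤ 0<σ ⊕ ≤⇒0≤ δ≤½ ∵ eq₁ σ δ)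
        (≤-by 0≤x² σ ⊕ 0≤x² σ ⊕ ≤⇒0≤ δ≤½ ∵ eq₂ σ δ)))
      (<-by 0<δ ∵ eq₀ σ δ)
      where
      eq₀ : ∀ σ δ → (σ * σ + ½) - (σ * σ + ½ - δ) ≡ δ
      eq₀ = solve-∀ ℚ-ring
      eq₁ : ∀ σ δ → (σ * σ + ½ - δ) - - (2ℚ * σ) ≡ σ * σ + 2ℚ * σ + (½ - δ)
      eq₁ = solve-∀ ℚ-ring
      eq₂ : ∀ σ δ → (σ * σ + ½ - δ) - - (σ * σ) ≡ σ * σ + σ * σ + (½ - δ)
      eq₂ = solve-∀ ℚ-ring
      eq₃ : ∀ σ ρ₀ ρ₁ K δ → (σ * σ + ½ - δ) - ρ₁ ≡
        ((ρ₀ - ρ₁) - (-½ + (2ℚ + 2ℚ + (K + K + K) + (K + K + K)) * δ))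
          + (δ - - (σ * σ - ρ₀)) + (K + K + K) * δ + (K + K + K) * δ + δ + δ
      eq₃ = solve-∀ ℚ-ring
      ρ₁≤ : ρ₁ ≤ σ * σ + ½ - δ
      ρ₁≤ = ≤-by ≤⇒0≤ diff ⊕ ≤⇒0≤ (ℚ.≤-trans (-x≤∣x∣ (σ * σ - ρ₀)) σ²≈ρ₀)
        ⊕ 0≤3Kδ ⊕ 0≤3Kδ ⊕ 0≤δ ⊕ 0≤δ ∵ eq₃ σ ρ₀ ρ₁ K δ
    ∣q-ρ₁∣≤2δ : ∣ q - ρ₁ ∣ ≤ δ + δ
    ∣q-ρ₁∣≤2δ = ∣x∣≤
      (≤-by ≤⇒0≤ q≤ρ₁+2δ ∵ eq₁ q ρ₁ δ)
      (≤-by ≤⇒0≤ (ℚ.p≤p⊔q ρ₁ m) ⊕ 0≤δ ⊕ 0≤δ ∵ eq₂ q ρ₁ δ)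
      where
      eq₁ : ∀ q ρ₁ δ → (δ + δ) - (q - ρ₁) ≡ (ρ₁ + (δ + δ)) - q
      eq₁ = solve-∀ ℚ-ring
      eq₂ : ∀ q ρ₁ δ → (δ + δ) - - (q - ρ₁) ≡ (q - ρ₁) + δ + δ
      eq₂ = solve-∀ ℚ-ring
      eq₃ : ∀ ρ₁ δ → (ρ₁ + (δ + δ)) - ρ₁ ≡ δ + δ
      eq₃ = solve-∀ ℚ-ring
      eq₄ : ∀ x ρ₁ δ → (ρ₁ + (δ + δ)) - x ≡ ((ρ₁ + δ) - x) + δ
      eq₄ = solve-∀ ℚ-ring
      eq₅ : ∀ σ ρ₀ ρ₁ δ → (ρ₁ + (δ + δ)) - - (σ * σ) ≡
        ((ρ₁ + δ) - - ρ₀) + (δ - - (σ * σ - ρ₀))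
      eq₅ = solve-∀ ℚ-ring
      q≤ρ₁+2δ : q ≤ ρ₁ + (δ + δ)
      q≤ρ₁+2δ = ℚ.⊔-lub (≤-by 0≤δ ⊕ 0≤δ ∵ eq₃ ρ₁ δ) (ℚ.⊔-lub
        (≤-by ≤⇒0≤ (ℚ.≤-trans (ℚ.p≤p⊔q (- (2ℚ * σ)) (- ρ₀)) lower) ⊕ 0≤δ ∵ eq₄ (- (2ℚ * σ)) ρ₁ δ)
        (≤-by ≤⇒0≤ (ℚ.≤-trans (ℚ.p≤q⊔p (- (2ℚ * σ)) (- ρ₀)) lower)
          ⊕ ≤⇒0≤ (ℚ.≤-trans (-x≤∣x∣ (σ * σ - ρ₀)) σ²≈ρ₀) ∵ eq₅ σ ρ₀ ρ₁ δ))
    e ê : ℕ → ℚ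
    e = recur ρ₀ ρ₁ β
    ê = recur (σ * σ) q β
    ∣xy∣≤ : ∀ {x y c d} → ∣ x ∣ ≤ c → ∣ y ∣ ≤ d → 0ℚ ≤ c → ∣ x * y ∣ ≤ c * d
    ∣xy∣≤ {x} {y} {c} {d} ∣x∣≤c ∣y∣≤d 0≤c = begin
      ∣ x * y ∣        ≡⟨ ℚ.∣p*q∣≡∣p∣*∣q∣ x y ⟩
      ∣ x ∣ * ∣ y ∣    ≤⟨ ℚ.*-monoʳ-≤-nonNeg ∣ y ∣ {{ℚ.∣-∣-nonNeg y}} ∣x∣≤c ⟩
      c * ∣ y ∣        ≤⟨ ℚ.*-monoˡ-≤-nonNeg c {{ℚ.nonNegative 0≤c}} ∣y∣≤d ⟩
      c * d            ∎
      where open ℚ.≤-Reasoning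
    ∣ê-e∣≤3Kδ : ∀ n → ∣ ê n - e n ∣ ≤ (K + K + K) * δ
    ∣ê-e∣≤3Kδ n = begin
      ∣ ê n - e n ∣
        ≡⟨ cong ∣_∣ (eq₁ (σ * σ) q ρ₀ ρ₁ (β n) (β (suc n)) (β (suc (suc n)))) ⟩
      ∣ (σ * σ - ρ₀) * β n + (q - ρ₁) * β (suc n) ∣
        ≤⟨ ℚ.∣p+q∣≤∣p∣+∣q∣ ((σ * σ - ρ₀) * β n) ((q - ρ₁) * β (suc n)) ⟩
      ∣ (σ * σ - ρ₀) * β n ∣ + ∣ (q - ρ₁) * β (suc n) ∣
        ≤⟨ ℚ.+-mono-≤ (∣xy∣≤ {σ * σ - ρ₀} σ²≈ρ₀ (∣b∣≤K n) 0≤δ)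
                     (∣xy∣≤ {q - ρ₁} ∣q-ρ₁∣≤2δ (∣b∣≤K (suc n)) (0≤δ ⊕ 0≤δ)) ⟩
      δ * K + (δ + δ) * K
        ≡⟨ eq₂ K δ ⟩
      (K + K + K) * δ ∎
      where
      open ℚ.≤-Reasoning
      eq₁ : ∀ q₀ q ρ₀ ρ₁ x y z → (q₀ * x + q * y + z) - (ρ₀ * x + ρ₁ * y + z) ≡
        (q₀ - ρ₀) * x + (q - ρ₁) * y
      eq₁ = solve-∀ ℚ-ring
      eq₂ : ∀ K δ → δ * K + (δ + δ) * K ≡ (K + K + K) * δ
      eq₂ = solve-∀ ℚ-ring
    upper-slack : ∀ n → 0ℚ ≤ (K + K + K) * δ - (ê n - e n)
    upper-slack n = ≤⇒0≤ (ℚ.≤-trans (x≤∣x∣ (ê n - e n)) (∣ê-e∣≤3Kδ n))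
    lower-slack : ∀ n → 0ℚ ≤ (K + K + K) * δ - - (ê n - e n)
    lower-slack n = ≤⇒0≤ (ℚ.≤-trans (-x≤∣x∣ (ê n - e n)) (∣ê-e∣≤3Kδ n))
    e<1 : ∀ n → ê n < 1ℚ
    e<1 n = <-by (≤⇒0≤ (e+γ≤1 n) ⊕ upper-slack n ⊕ 0≤3Kδ ⊕ 0≤δ ⊕ 0≤δ ⊕ 0≤δ) ⊕< 0<δ
      ∵ eq (e n) (ê n) K δ
      where
      eq : ∀ e ê K δ → 1ℚ - ê ≡
        (1ℚ - (e + (2ℚ + 2ℚ + (K + K + K) + (K + K + K)) * δ)) + ((K + K + K) * δ - (ê - e))
          + (K + K + K) * δ + δ + δ + δ + δ
      eq = solve-∀ ℚ-ring
    -1<e : ∀ n → - 1ℚ < ê n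
    -1<e n = <-by
      (0≤e+δ n ⊕ lower-slack n ⊕ ≤⇒0≤ γ≤½ ⊕ 0≤3Kδ ⊕ 0≤δ ⊕ 0≤δ ⊕ 0≤δ) ⊕< 0<½
      ∵ eq (e n) (ê n) K δ
      where
      eq : ∀ e ê K δ → ê - - 1ℚ ≡
        (e + δ) + ((K + K + K) * δ - - (ê - e))
          + (½ - (2ℚ + 2ℚ + (K + K + K) + (K + K + K)) * δ) + (K + K + K) * δ + δ + δ + δ + ½
      eq = solve-∀ ℚ-ring
    spread : ∀ m n → ê m - ê n ≤ 1ℚ
    spread m n = ≤-by
      ≤⇒0≤ (e+γ≤1 m) ⊕ upper-slack m ⊕ 0≤e+δ n ⊕ lower-slack n ⊕ 0≤δ ⊕ 0≤δ ⊕ 0≤δ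
      ∵ eq (e m) (ê m) (e n) (ê n) K δ
      where
      eq : ∀ e ê e′ ê′ K δ → 1ℚ - (ê - ê′) ≡
        (1ℚ - (e + (2ℚ + 2ℚ + (K + K + K) + (K + K + K)) * δ)) + ((K + K + K) * δ - (ê - e))
          + (e′ + δ) + ((K + K + K) * δ - - (ê′ - e′)) + δ + δ + δ
      eq = solve-∀ ℚ-ring

  divide : ∀ c → 0ℚ < c → ∀ {ε} → 0ℚ < ε → ∃[ δ ] (0ℚ < δ × c * δ ≡ ε)
  divide c 0<c {ε} 0<ε = c⁻¹ * ε , ℚ.positive⁻¹ c⁻¹ {{ℚ.1/pos⇒pos c}} ⊗< 0<ε ,
    trans (sym (ℚ.*-assoc c c⁻¹ ε)) (trans (cong (_* ε) (ℚ.*-inverseʳ c)) (ℚ.*-identityˡ ε))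
    where
    instance
      c-pos : ℚ.Positive c
      c-pos = ℚ.positive 0<c
      c-nonZero : ℚ.NonZero c
      c-nonZero = ℚ.pos⇒nonZero c
    c⁻¹ : ℚ
    c⁻¹ = ℚ.1/ c

-- Properties of all late terms.

module Eventually where

  -- The inner shape of the order and equality on ℝ, so their proofs are used here without
  -- conversion.
  Eventually : (ℕ → Set) → Set
  Eventually P = ∃[ N ] (∀ M → N ℕ.≤ M → P M)

  infixr 5 _∧_

  _∧_ : ∀ {P Q} → Eventually P → Eventually Q → Eventually (λ M → P M × Q M)
  (N , p) ∧ (N′ , q) = N ℕ.⊔ N′ , λ M h →
    p M (ℕ.m⊔n≤o⇒m≤o N N′ h) , q M (ℕ.m⊔n≤o⇒n≤o N N′ h)

  -- Finitely many thresholds have a common bound. One period of recurrence values suffices, since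
  -- `every-residue` extends the result to all indices.
  eventually-below : ∀ {P : ℕ → ℕ → Set} → (∀ n → Eventually (P n)) →
    ∀ k → Eventually (λ M → ∀ n → n ℕ.< k → P n M)
  eventually-below ev zero = 0 , λ _ _ _ ()
  eventually-below {P} ev (suc k) with ev k ∧ eventually-below ev k
  ... | N , h = N , λ M N≤M n n<1+k → case M N≤M n (ℕ.m<1+n⇒m<n∨m≡n n<1+k)
    where
    case : ∀ M → N ℕ.≤ M → ∀ n → n ℕ.< k ⊎ n ≡ k → P n M
    case M N≤M n (inj₁ n<k)  = proj₂ (h M N≤M) n n<k
    case M N≤M n (inj₂ refl) = proj₁ (h M N≤M)

  eventually-here : ∀ {P} → Eventually P → ∃[ M ] P M
  eventually-here (N , p) = N , p N ℕ.≤-refl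

-- From real parameters to a single rational instance.

open RationalArithmetic
open Periodicity
open PeriodicOrbits
open Perturbation
open Eventually

open import Defs

0<⊓ : ∀ {x y} → 0ℚ ℚ.< x → 0ℚ ℚ.< y → 0ℚ ℚ.< x ℚ.⊓ y
0<⊓ {x} {y} 0<x 0<y with ℚ.⊓-sel x y
... | inj₁ eq = subst (0ℚ ℚ.<_) (sym eq) 0<x
... | inj₂ eq = subst (0ℚ ℚ.<_) (sym eq) 0<y

floor-lower : ∀ x {δ i k} → i ≡ ℤ.- k → ι k ℚ.≤ x ℚ.+ δ → 0ℚ ℚ.≤ (x ℚ.+ ι i) ℚ.+ δ
floor-lower x {δ} {k = k} refl k≤x+δ rewrite ι-neg k = ≤-by ≤⇒0≤ k≤x+δ ∵ eq x (ι k) δ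
  where
  eq : ∀ x k δ → ((x ℚ.+ (ℚ.- k)) ℚ.+ δ) ℚ.- 0ℚ ≡ (x ℚ.+ δ) ℚ.- k
  eq = solve-∀ ℚ-ring

floor-upper : ∀ x {ε i k} → i ≡ ℤ.- k → x ℚ.+ ε ℚ.≤ ι (k ℤ.+ + 1) → (x ℚ.+ ι i) ℚ.+ ε ℚ.≤ 1ℚ
floor-upper x {ε} {k = k} refl x+ε≤k+1 rewrite ι-neg k =
  ≤-by ≤⇒0≤ (subst (x ℚ.+ ε ℚ.≤_) (ι-+ k (+ 1)) x+ε≤k+1) ∵ eq x (ι k) ε
  where
  eq : ∀ x k ε → 1ℚ ℚ.- ((x ℚ.+ (ℚ.- k)) ℚ.+ ε) ≡ (k ℚ.+ 1ℚ) ℚ.- (x ℚ.+ ε)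
  eq = solve-∀ ℚ-ring

recur-periodic : ∀ {p c} q₀ q₁ → Periodic p c → Periodic p (recur q₀ q₁ c)
recur-periodic q₀ q₁ per n = cong₂ ℚ._+_
  (cong₂ (λ x y → q₀ ℚ.* x ℚ.+ q₁ ℚ.* y) (per n) (per (suc n))) (per (suc (suc n)))

-- The factor 4 + 6K pays for the error δ K + 2δ K of each recurrence value at both ends,
-- plus a few multiples of δ itself.
slack : ∀ {g₀ g₁ g₂ K} → 0ℚ ℚ.< g₀ → 0ℚ ℚ.< g₁ → 0ℚ ℚ.< g₂ → 0ℚ ℚ.≤ K →
  ∃[ γ ] ∃[ δ ] (0ℚ ℚ.< δ ×
    (2ℚ ℚ.+ 2ℚ ℚ.+ (K ℚ.+ K ℚ.+ K) ℚ.+ (K ℚ.+ K ℚ.+ K)) ℚ.* δ ≡ γ ×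
    γ ℚ.≤ g₀ × γ ℚ.≤ g₁ × γ ℚ.≤ g₂ × γ ℚ.≤ ½)
slack {g₀} {g₁} {g₂} {K} 0<g₀ 0<g₁ 0<g₂ 0≤K =
  let δ , 0<δ , scale = divide (2ℚ ℚ.+ 2ℚ ℚ.+ (K ℚ.+ K ℚ.+ K) ℚ.+ (K ℚ.+ K ℚ.+ K)) 0<4+6K
        (0<⊓ (0<⊓ 0<g₀ 0<g₁) (0<⊓ 0<g₂ 0<½))
  in (g₀ ℚ.⊓ g₁) ℚ.⊓ (g₂ ℚ.⊓ ½) , δ , 0<δ , scale ,
  ℚ.≤-trans (ℚ.p⊓q≤p (g₀ ℚ.⊓ g₁) (g₂ ℚ.⊓ ½)) (ℚ.p⊓q≤p g₀ g₁) ,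
  ℚ.≤-trans (ℚ.p⊓q≤p (g₀ ℚ.⊓ g₁) (g₂ ℚ.⊓ ½)) (ℚ.p⊓q≤q g₀ g₁) ,
  ℚ.≤-trans (ℚ.p⊓q≤q (g₀ ℚ.⊓ g₁) (g₂ ℚ.⊓ ½)) (ℚ.p⊓q≤p g₂ ½) ,
  ℚ.≤-trans (ℚ.p⊓q≤q (g₀ ℚ.⊓ g₁) (g₂ ℚ.⊓ ½)) (ℚ.p⊓q≤q g₂ ½)
  where
  eq : ∀ K → (2ℚ ℚ.+ 2ℚ ℚ.+ (K ℚ.+ K ℚ.+ K) ℚ.+ (K ℚ.+ K ℚ.+ K)) ℚ.- 0ℚ ≡
    K ℚ.+ K ℚ.+ K ℚ.+ K ℚ.+ K ℚ.+ K ℚ.+ (2ℚ ℚ.+ 2ℚ)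
  eq = solve-∀ ℚ-ring
  0<4 : 0ℚ ℚ.< 2ℚ ℚ.+ 2ℚ
  0<4 = ℚ.positive⁻¹ _
  0<4+6K : 0ℚ ℚ.< 2ℚ ℚ.+ 2ℚ ℚ.+ (K ℚ.+ K ℚ.+ K) ℚ.+ (K ℚ.+ K ℚ.+ K)
  0<4+6K = <-by (0≤K ⊕ 0≤K ⊕ 0≤K ⊕ 0≤K ⊕ 0≤K ⊕ 0≤K) ⊕< 0<4 ∵ eq K

theorem5 : ∀ (r₀ r₁ √r₀ √2 : ℝ) → IsSqrt r₀ √r₀ → IsSqrt (fromℤ (+ 2)) √2 →
    r₀ - r₁ > fromℚ -½ →
    r₁ ≥ (- (fromℤ (+ 2) * √r₀)) ⊔ (- r₀) →
    r₀ > fromℚ (+ 3 / 2) + √2 →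
    𝒟₂* (r₀ , r₁)
theorem5 r₀ r₁ √r₀ √2 (0≤√r₀ , √r₀²≈r₀) (0≤√2 , √2²≈2) (g₁ , 0<g₁ , diff) lower (g₂ , 0<g₂ , gap)
  a orbit (n₀ , p , 0<p , a-per) = n₀ , λ n n₀≤n →
    trans (cong a (sym (ℕ.m∸n+n≡m n₀≤n))) (zero-tail (n ℕ.∸ n₀))
  where
  instance
    p-nonZero : ℕ.NonZero p
    p-nonZero = ℕ.>-nonZero 0<p

  b : ℕ → ℤ
  b n = a (n ℕ.+ n₀)

  b-per : Periodic p b
  b-per n = trans
    (cong a (trans (ℕ.+-assoc n p n₀)
      (trans (cong (n ℕ.+_) (ℕ.+-comm p n₀)) (sym (ℕ.+-assoc n n₀ p)))))
    (a-per (n ℕ.+ n₀) (ℕ.m≤n+m n₀ n))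

  β : ℕ → ℚ
  β n = ι (b n)

  e : ℕ → ℕ → ℚ
  e n M = recur (seq r₀ M) (seq r₁ M) β n

  x : ℕ → ℕ → ℚ
  x n M = seq r₀ M ℚ.* β n ℚ.+ seq r₁ M ℚ.* β (suc n)

  every-residue : ∀ {P : ℚ → Set} M → (∀ n → n ℕ.< p → P (e n M)) → ∀ n → P (e n M)
  every-residue {P} M h n = subst P
    (sym (periodic-% {f = λ n → e n M} (recur-periodic (seq r₀ M) (seq r₁ M) (λ n → cong ι (b-per n))) n))
    (h (n ℕ.% p) (ℕ.m%n<n n p))

  nonneg : ∀ n δ → 0ℚ ℚ.< δ → Eventually (λ M → 0ℚ ℚ.≤ e n M ℚ.+ δ)
  nonneg n δ 0<δ with orbit (n ℕ.+ n₀)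
  ... | _ , k , (k≤ , _) , b≡-k with k≤ δ 0<δ
  ...   | N , h = N , λ M N≤M → floor-lower (x n M) {δ} {k = k} b≡-k (h M N≤M)

  below-one : ∀ n → ∃[ ε ] (0ℚ ℚ.< ε × Eventually (λ M → e n M ℚ.+ ε ℚ.≤ 1ℚ))
  below-one n with orbit (n ℕ.+ n₀)
  ... | _ , k , (_ , ε , 0<ε , N , h) , b≡-k =
    ε , 0<ε , N , λ M N≤M → floor-upper (x n M) {ε} {k = k} b≡-k (h M N≤M)

  g : ℕ → ℚ
  g n = proj₁ (below-one n)

  -- The margins come from separate floor witnesses and need not repeat with the period, so the
  -- least one is taken over the first p indices only.
  min-g : ∃[ m ] (∀ n → n ℕ.< p → g m ℚ.≤ g n)
  min-g with maximum-below (λ n → ℚ.- g n) p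
  ... | m , h = m , λ n n<p → ≤-by ≤⇒0≤ (h n n<p) ∵ eq (g m) (g n)
    where
    eq : ∀ x y → y ℚ.- x ≡ (ℚ.- x) ℚ.- (ℚ.- y)
    eq = solve-∀ ℚ-ring

  g₀ : ℚ
  g₀ = g (proj₁ min-g)

  max-β = maximum {f = λ n → ℚ.∣ β n ∣} (λ n → cong (λ i → ℚ.∣ ι i ∣) (b-per n))

  K : ℚ
  K = ℚ.∣ β (proj₁ max-β) ∣

  0≤K : 0ℚ ℚ.≤ K
  0≤K = ℚ.0≤∣p∣ (β (proj₁ max-β))

  conclude :
    ∃[ γ ] ∃[ δ ] (0ℚ ℚ.< δ ×
      (2ℚ ℚ.+ 2ℚ ℚ.+ (K ℚ.+ K ℚ.+ K) ℚ.+ (K ℚ.+ K ℚ.+ K)) ℚ.* δ ≡ γ ×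
      γ ℚ.≤ g₀ × γ ℚ.≤ g₁ × γ ℚ.≤ g₂ × γ ℚ.≤ ½) →
    ∀ n → b n ≡ + 0
  -- The precision δ is fixed from the margins and `K` first; only then is one index M chosen at
  -- which every hypothesis holds.
  conclude (γ , δ , 0<δ , scale , γ≤g₀ , γ≤g₁ , γ≤g₂ , γ≤½) = at (eventually-here
    (√r₀²≈r₀ δ 0<δ ∧ 0≤√r₀ δ 0<δ ∧ √2²≈2 δ 0<δ ∧ 0≤√2 δ 0<δ ∧ diff ∧ lower δ 0<δ ∧ gap
      ∧ eventually-below (λ n → nonneg n δ 0<δ) p
      ∧ eventually-below (λ n → proj₂ (proj₂ (below-one n))) p))
    where
    at : ∃[ M ] (
      ℚ.∣ seq √r₀ M ℚ.* seq √r₀ M ℚ.- seq r₀ M ∣ ℚ.≤ δ ×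
      0ℚ ℚ.≤ seq √r₀ M ℚ.+ δ ×
      ℚ.∣ seq √2 M ℚ.* seq √2 M ℚ.- 2ℚ ∣ ℚ.≤ δ ×
      0ℚ ℚ.≤ seq √2 M ℚ.+ δ ×
      -½ ℚ.+ g₁ ℚ.≤ seq r₀ M ℚ.- seq r₁ M ×
      (ℚ.- (2ℚ ℚ.* seq √r₀ M)) ℚ.⊔ (ℚ.- seq r₀ M) ℚ.≤ seq r₁ M ℚ.+ δ ×
      3/2 ℚ.+ seq √2 M ℚ.+ g₂ ℚ.≤ seq r₀ M ×
      (∀ n → n ℕ.< p → 0ℚ ℚ.≤ e n M ℚ.+ δ) ×
      (∀ n → n ℕ.< p → e n M ℚ.+ g n ℚ.≤ 1ℚ)) →
      ∀ n → b n ≡ + 0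
    at (M , σ²≈ρ₀ , 0≤σ+δ , w²≈2 , 0≤w+δ , diff′ , lower′ , gap′ , e-nonneg , e-below-one) =
      perturbed⇒zero {b = b} {seq √r₀ M} {seq r₀ M} {seq r₁ M} {seq √2 M} {γ} {δ} {K}
        b-per 0<δ 0≤K scale γ≤½ (proj₂ max-β)
        σ²≈ρ₀ 0≤σ+δ w²≈2 0≤w+δ
        (ℚ.≤-trans (ℚ.+-monoʳ-≤ -½ γ≤g₁) diff′)
        lower′
        (ℚ.≤-trans (ℚ.+-monoʳ-≤ (3/2 ℚ.+ seq √2 M) γ≤g₂) gap′)
        (every-residue {λ y → 0ℚ ℚ.≤ y ℚ.+ δ} M e-nonneg)
        (every-residue {λ y → y ℚ.+ γ ℚ.≤ 1ℚ} M λ n n<p → ℚ.≤-trans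
          (ℚ.+-monoʳ-≤ (e n M) (ℚ.≤-trans γ≤g₀ (proj₂ min-g n n<p))) (e-below-one n n<p))

  zero-tail : ∀ n → b n ≡ + 0
  zero-tail = conclude (slack (proj₁ (proj₂ (below-one (proj₁ min-g)))) 0<g₁ 0<g₂ 0≤K)
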